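{- Let $T$ be a tree with $l$ leaves and maximum degree at most $\Delta$, and let $H$ be a graph satisfying $l\geq 13\Delta|H|+1$. Then $T$ is $H$-good.
   Context: For graphs $G,H$, the Ramsey number $R(G,H)$ is the smallest $N$ such that every red-blue coloring of the edges of $K_N$ contains a red copy of $G$ or a blue copy of $H$. $\chi(H)$ is the chromatic number of $H$, and $\sigma(H)$ is the minimum, over all proper $\chi(H)$-colorings of $H$, of the size of the smallest color class. A connected graph $G$ is called $H$-good if $R(G,H)=(|G|-1)(\chi(H)-1)+\sigma(H)$. $|H|$ denotes the number of vertices of $H$. -}

module Defs where

open import Data.Nat using (ℕ; zero; suc; _+_; _*_; _∸_; _≤_; _<_)
open import Data.Bool using (Bool; true; false)
open import Data.Fin using (Fin)
open import Data.Fin.Properties using (_≟_)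
open import Data.List using (List; length; filterᵇ; allFin)
open import Data.Product using (Σ; _×_; ∃; ∃-syntax; _,_)
open import Relation.Nullary using (¬_; does)
open import Relation.Binary.PropositionalEquality using (_≡_; _≢_)
open import Function.Definitions using (Injective)

record Graph (n : ℕ) : Set where
  field
    adj    : Fin n → Fin n → Bool
    sym    : ∀ i j → adj i j ≡ adj j i
    irrefl : ∀ i → adj i i ≡ false
open Graph public

count : ∀ {n} → (Fin n → Bool) → ℕ
count {n} p = length (filterᵇ p (allFin n))

degree : ∀ {n} → Graph n → Fin n → ℕ
degree G v = count (adj G v)

numLeaves : ∀ {n} → Graph n → ℕ
numLeaves {n} G = count (λ v → does (degree G v Data.Nat.≟ 1))

MaxDegreeAtMost : ∀ {n} → Graph n → ℕ → Set
MaxDegreeAtMost G Δ = ∀ v → degree G v ≤ Δ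

data Reach {n} (G : Graph n) : Fin n → Fin n → Set where
  here : ∀ {u} → Reach G u u
  step : ∀ {u w v} → adj G u w ≡ true → Reach G w v → Reach G u v

Connected : ∀ {n} → Graph n → Set
Connected {n} G = (1 ≤ n) × (∀ u v → Reach G u v)

HasCycle : ∀ {n} → Graph n → Set
HasCycle {n} G =
  Σ ℕ λ k → Σ (Fin (3 + k) → Fin n) λ c →
    Injective _≡_ _≡_ c ×
    (∀ (i : Fin (2 + k)) → adj G (c (Data.Fin.inject₁ i)) (c (Data.Fin.suc i)) ≡ true) ×
    (adj G (c (Data.Fin.fromℕ (2 + k))) (c Data.Fin.zero) ≡ true)

IsTree : ∀ {n} → Graph n → Set
IsTree G = Connected G × ¬ HasCycle G

-- red/blue colourings of the edges of K_N (true = red, false = blue), symmetric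
record EdgeColouring (N : ℕ) : Set where
  field
    col    : Fin N → Fin N → Bool
    colSym : ∀ i j → col i j ≡ col j i
open EdgeColouring public

MonoCopy : ∀ {n N} → Graph n → EdgeColouring N → Bool → Set
MonoCopy {n} {N} G c b =
  Σ (Fin n → Fin N) λ f → Injective _≡_ _≡_ f ×
    (∀ i j → adj G i j ≡ true → col c (f i) (f j) ≡ b)

Arrows : ∀ {n m} → ℕ → Graph n → Graph m → Set
Arrows N G H = (c : EdgeColouring N) → MonoCopy G c true Data.Sum.⊎ MonoCopy H c false
  where import Data.Sum

IsRamseyNumber : ∀ {n m} → Graph n → Graph m → ℕ → Set
IsRamseyNumber G H N = Arrows N G H × (∀ M → Arrows M G H → N ≤ M)

ProperColouring : ∀ {n} → Graph n → ℕ → Set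
ProperColouring {n} H k =
  Σ (Fin n → Fin k) λ φ → ∀ i j → adj H i j ≡ true → φ i ≢ φ j

IsChromaticNumber : ∀ {n} → Graph n → ℕ → Set
IsChromaticNumber H k = ProperColouring H k × (∀ m → ProperColouring H m → k ≤ m)

classSize : ∀ {n k} → (Fin n → Fin k) → Fin k → ℕ
classSize φ a = count (λ v → does (φ v ≟ a))

-- σ(H) = s, where k = χ(H): minimum over proper k-colourings of the smallest class size
IsSigma : ∀ {n} → Graph n → ℕ → ℕ → Set
IsSigma H k s =
  (Σ (ProperColouring H k) λ { (φ , _) → ∃[ a ] classSize φ a ≡ s }) ×
  (∀ (P : ProperColouring H k) (a : Fin k) → s ≤ classSize (Data.Product.proj₁ P) a)

IsGood : ∀ {n m} → Graph n → Graph m → Set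
IsGood {n} G H = Connected G ×
  (∀ k s → IsChromaticNumber H k → IsSigma H k s →
     IsRamseyNumber G H ((n ∸ 1) * (k ∸ 1) + s))

{-# OPTIONS --safe #-}
module Submission where

-- Upper bound.  Process the colour classes of H one at a time inside a shrinking host set S.
-- Either some X ⊆ S, at least as large as the next class, is joined in blue to so many vertices
-- of S that the remaining classes can be found there, or every X ⊆ S with ∣ X ∣ ≥ ∣ H ∣ satisfies
-- ∣ (X ∪ Γ X) ∩ S ∣ ≥ ∣ T ∣, where Γ is the red neighbourhood.  In the second case T embeds in red.
-- Remove from S a largest set B that expands by at most the factor Δ; it has fewer than ∣ H ∣
-- elements, and small subsets of V = S ∖ B expand in V.  The non-leaves of T are embedded in V
-- one by one, in the manner of Friedman and Pippenger: every used vertex demands as many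
-- neighbours as it still needs, every other vertex demands Δ, and every small set X must have
-- at least as many free neighbours as its total demand.  The leaves leave enough room for this.
-- When only leaves remain, the condition holds for all sets (it is Hall's condition) even with
-- the vertices of B made available again, and the same argument places the leaves.
--
-- Lower bound.  Take red cliques of orders ∣ T ∣ - 1 (χ(H) - 1 times) and σ(H) - 1, with all
-- edges between them blue.

open import Defs hiding (sym)
open import Data.Bool using (Bool; true; false; _∧_; _∨_; not; if_then_else_) renaming (T to IsTrue)
open import Data.Bool.Properties using (∧-conicalˡ; ∧-conicalʳ; ¬-not)
import Data.Bool.Properties as Bool
open import Data.Fin
  using (Fin; zero; suc; inject₁; inject≤; fromℕ; fromℕ<; splitAt; remQuot; combine; punchIn; punchOut;
         _↑ˡ_; _↑ʳ_)
open import Data.Fin.Properties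
  using (_≟_; any?; all?; suc-injective; splitAt⁻¹-↑ˡ; splitAt⁻¹-↑ʳ; combine-remQuot;
         inject≤-injective; injective⇒≤; punchIn-punchOut; punchOut-injective)
open import Data.Fin.Subset.Properties using (anySubset?)
open import Data.List using (List; []; _∷_; length; tabulate; filterᵇ)
open import Data.List.Properties using (length-tabulate)
open import Data.List.Relation.Unary.Any using (Any; here; there)
open import Data.List.Relation.Unary.Any.Properties using (tabulate⁺)
open import Data.Nat using (ℕ; zero; suc; pred; _+_; _*_; _∸_; _≤_; _<_; z≤n; s≤s; >-nonZero)
open import Data.Nat.Properties hiding (_≟_; suc-injective)
import Data.Nat as ℕ
open import Data.Nat.Solver using (module +-*-Solver)
open import Data.Product using (Σ; _×_; ∃; ∃-syntax; _,_; proj₁; proj₂)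
open import Data.Sum using (_⊎_; inj₁; inj₂; [_,_]′)
open import Data.Unit using (⊤; tt)
import Data.Vec as Vec
open import Data.Vec.Properties using (lookup∘tabulate)
open import Algebra.Properties.CommutativeMonoid.Sum +-0-commutativeMonoid using (∑-distrib-+; ∑-comm)
open import Algebra.Properties.Semiring.Sum +-*-semiring
  using (sum; sum-syntax; *-distribˡ-sum; sum-cong-≗; sum-replicate-zero)
open import Function using (_∘_; id)
open import Function.Definitions using (Injective)
open import Relation.Nullary using (¬_; Dec; yes; no; does; contradiction)
open import Relation.Nullary.Decidable using (_×-dec_; _→-dec_; dec-true; dec-false)
open import Relation.Binary.PropositionalEquality
  using (_≡_; _≢_; _≗_; refl; sym; trans; cong; cong₂; subst; subst₂)

-- Finite sets and weights

Sub : ℕ → Set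
Sub n = Fin n → Bool

infix 4 _∈_ _∉_ _⊆_

_∈_ _∉_ : ∀ {n} → Fin n → Sub n → Set
i ∈ X = X i ≡ true
i ∉ X = X i ≡ false

_⊆_ : ∀ {n} → Sub n → Sub n → Set
X ⊆ Y = ∀ i → i ∈ X → i ∈ Y

infixr 6 _∪_
infixr 7 _∩_ _∖_

_∪_ _∩_ _∖_ : ∀ {n} → Sub n → Sub n → Sub n
(X ∪ Y) i = X i ∨ Y i
(X ∩ Y) i = X i ∧ Y i
(X ∖ Y) i = X i ∧ not (Y i)

∁ : ∀ {n} → Sub n → Sub n
∁ X i = not (X i)

∅ : ∀ {n} → Sub n
∅ _ = false

⁅_⁆ : ∀ {n} → Fin n → Sub n
⁅ x ⁆ i = does (i ≟ x)

module _ {n : ℕ} where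

  mem? : (X : Sub n) (i : Fin n) → i ∈ X ⊎ i ∉ X
  mem? X i with X i
  ... | true  = inj₁ refl
  ... | false = inj₂ refl

  ∈∉ : ∀ {a} {A : Set a} {X : Sub n} {i} → i ∈ X → i ∉ X → A
  ∈∉ p q with () ← trans (sym p) q

  ∪⁻ : ∀ (X Y : Sub n) {i} → i ∈ X ∪ Y → i ∈ X ⊎ i ∈ Y
  ∪⁻ X Y {i} p with X i
  ... | true  = inj₁ refl
  ... | false = inj₂ p

  ∪⁺ˡ : ∀ (X Y : Sub n) {i} → i ∈ X → i ∈ X ∪ Y
  ∪⁺ˡ X Y p rewrite p = refl

  ∪⁺ʳ : ∀ (X Y : Sub n) {i} → i ∈ Y → i ∈ X ∪ Y
  ∪⁺ʳ X Y p rewrite p = Bool.∨-zeroʳ _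

  ∩⁺ : ∀ (X Y : Sub n) {i} → i ∈ X → i ∈ Y → i ∈ X ∩ Y
  ∩⁺ X Y p q rewrite p | q = refl

  ∩⁻ : ∀ (X Y : Sub n) {i} → i ∈ X ∩ Y → i ∈ X × i ∈ Y
  ∩⁻ X Y {i} p = ∧-conicalˡ _ _ p , ∧-conicalʳ (X i) _ p

  ∖⁺ : ∀ (X Y : Sub n) {i} → i ∈ X → i ∉ Y → i ∈ X ∖ Y
  ∖⁺ X Y p q rewrite p | q = refl

  ∖⁻ : ∀ (X Y : Sub n) {i} → i ∈ X ∖ Y → i ∈ X × i ∉ Y
  ∖⁻ X Y {i} p with X i | Y i
  ... | true | false = refl , refl

  ∁⁻ : ∀ (X : Sub n) {i} → i ∈ ∁ X → i ∉ X
  ∁⁻ X {i} p = trans (sym (Bool.not-involutive (X i))) (cong not p)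

  ⁅⁆⁺ : ∀ (x : Fin n) → x ∈ ⁅ x ⁆
  ⁅⁆⁺ x = dec-true (x ≟ x) refl

  ⁅⁆⁻ : ∀ (x i : Fin n) → i ∈ ⁅ x ⁆ → i ≡ x
  ⁅⁆⁻ x i p with yes q ← i ≟ x = q

  ≢⇒∉⁅⁆ : ∀ (x i : Fin n) → i ≢ x → i ∉ ⁅ x ⁆
  ≢⇒∉⁅⁆ x i = dec-false (i ≟ x)

  ∈? : (X : Sub n) → ∀ i → Dec (i ∈ X)
  ∈? X i = X i Bool.≟ true

sum-mono : ∀ {n} {f g : Fin n → ℕ} → (∀ i → f i ≤ g i) → sum f ≤ sum g
sum-mono {zero}  _ = z≤n
sum-mono {suc n} p = +-mono-≤ (p zero) (sum-mono (p ∘ suc))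

opaque

  -- Cardinalities and total demands are both instances of `weight`, so a single modularity law
  -- serves both sides of the expansion inequality.
  weight : ∀ {n} → (Fin n → ℕ) → Sub n → ℕ
  weight {n} w X = ∑[ i < n ] (if X i then w i else 0)

∣_∣ : ∀ {n} → Sub n → ℕ
∣ X ∣ = weight (λ _ → 1) X

opaque
  unfolding weight

  count≡∣∣ : ∀ {n} (X : Sub n) → count X ≡ ∣ X ∣
  count≡∣∣ X = go X id
    where
    -- `allFin` is `tabulate id`; the induction needs an arbitrary map in place of `id`.
    go : ∀ {n m} (X : Sub m) (g : Fin n → Fin m) →
         length (filterᵇ X (tabulate g)) ≡ ∣ X ∘ g ∣
    go {zero}  X g = refl
    go {suc n} X g with X (g zero)
    ... | true  = cong suc (go X (g ∘ suc))
    ... | false = go X (g ∘ suc)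

  card-suc : ∀ {n} (X : Sub (suc n)) → ∣ X ∣ ≡ (if X zero then 1 else 0) + ∣ X ∘ suc ∣
  card-suc X = refl

  weight-mono : ∀ {n} {w v : Fin n → ℕ} {X Y} → X ⊆ Y →
                (∀ i → i ∈ X → w i ≤ v i) → weight w X ≤ weight v Y
  weight-mono {n} {w} {v} {X} {Y} X⊆Y w≤v = sum-mono pt
    where
    pt : ∀ i → (if X i then w i else 0) ≤ (if Y i then v i else 0)
    pt i with X i in p
    ... | false = z≤n
    ... | true rewrite X⊆Y i p = w≤v i p

  weight-support : ∀ {n} (w : Fin n → ℕ) {X Y} → (∀ i → i ∈ X → i ∉ Y → w i ≡ 0) →
                   weight w X ≤ weight w Y
  weight-support {n} w {X} {Y} w0 = sum-mono pt
    where
    pt : ∀ i → (if X i then w i else 0) ≤ (if Y i then w i else 0)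
    pt i with X i in p | Y i in q
    ... | false | _     = z≤n
    ... | true  | true  = ≤-refl
    ... | true  | false = ≤-reflexive (w0 i p q)

  weight-cong : ∀ {n} (w : Fin n → ℕ) {X Y} → X ≗ Y → weight w X ≡ weight w Y
  weight-cong {n} w p = sum-cong-≗ {n} λ i → cong (if_then w i else 0) (p i)

  weight-const : ∀ {n} k (X : Sub n) → weight (λ _ → k) X ≡ k * ∣ X ∣
  weight-const {n} k X =
    trans (sum-cong-≗ {n} pt) (sym (*-distribˡ-sum {n} k (λ i → if X i then 1 else 0)))
    where
    pt : ∀ i → (if X i then k else 0) ≡ k * (if X i then 1 else 0)
    pt i with X i
    ... | true  = sym (*-identityʳ k)
    ... | false = sym (*-zeroʳ k)

  weight-modular : ∀ {n} (w : Fin n → ℕ) X Y →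
                   weight w (X ∪ Y) + weight w (X ∩ Y) ≡ weight w X + weight w Y
  weight-modular {n} w X Y =
    trans (sym (∑-distrib-+ {n} (on (X ∪ Y)) (on (X ∩ Y))))
      (trans (sum-cong-≗ {n} pt) (∑-distrib-+ {n} (on X) (on Y)))
    where
    on : Sub n → Fin n → ℕ
    on Z i = if Z i then w i else 0
    pt : ∀ i → on (X ∪ Y) i + on (X ∩ Y) i ≡ on X i + on Y i
    pt i with X i | Y i
    ... | true  | true  = refl
    ... | true  | false = refl
    ... | false | true  = +-identityʳ _
    ... | false | false = refl

  weight-⁅⁆ : ∀ {n} (w : Fin n → ℕ) x → weight w ⁅ x ⁆ ≡ w x
  weight-⁅⁆ {suc n} w zero    = trans (cong (w zero +_) (sum-replicate-zero n)) (+-identityʳ _)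
  weight-⁅⁆ {suc n} w (suc x) = weight-⁅⁆ (w ∘ suc) x

  weight-∅ : ∀ {n} (w : Fin n → ℕ) {X} → (∀ i → i ∉ X) → weight w X ≡ 0
  weight-∅ {n} w X∅ =
    trans (sum-cong-≗ {n} λ i → cong (if_then w i else 0) (X∅ i)) (sum-replicate-zero n)

  card-all : ∀ {n} {X : Sub n} → (∀ i → i ∈ X) → ∣ X ∣ ≡ n
  card-all {n} X⊤ = trans (weight-cong _ X⊤) (ones n)
    where
    ones : ∀ n → ∣ (λ (_ : Fin n) → true) ∣ ≡ n
    ones zero    = refl
    ones (suc n) = cong suc (ones n)

  -- Double counting: both sides sum `v i j` over the pairs with `i ∈ X` and `j ∈ R i`.
  weight-comm : ∀ {m n} (v : Fin m → Fin n → ℕ) (X : Sub m) (R : Fin m → Sub n) →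
                weight (λ i → weight (v i) (R i)) X
                ≡ weight (λ j → weight (λ i → v i j) (X ∩ λ i → R i j)) (λ _ → true)
  weight-comm {m} {n} v X R = trans (sum-cong-≗ {m} pt)
    (∑-comm {m} {n} λ i j → if X i ∧ R i j then v i j else 0)
    where
    pt : ∀ i → (if X i then weight (v i) (R i) else 0)
             ≡ ∑[ j < n ] (if X i ∧ R i j then v i j else 0)
    pt i with X i
    ... | true  = refl
    ... | false = sym (sum-replicate-zero n)

module _ {n : ℕ} where

  card-mono : {X Y : Sub n} → X ⊆ Y → ∣ X ∣ ≤ ∣ Y ∣
  card-mono X⊆Y = weight-mono X⊆Y λ _ _ → ≤-refl

  weight-disjoint : ∀ (w : Fin n → ℕ) {X Y} → (∀ i → i ∈ X → i ∉ Y) →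
                    weight w (X ∪ Y) ≡ weight w X + weight w Y
  weight-disjoint w {X} {Y} dis = trans (sym (+-identityʳ _)) (trans
    (cong (weight w (X ∪ Y) +_) (sym (weight-∅ w empty))) (weight-modular w X Y))
    where
    empty : ∀ i → i ∉ X ∩ Y
    empty i with X i in p
    ... | true  = dis i p
    ... | false = refl

  card-insert : ∀ {X : Sub n} {x} → x ∉ X → ∣ X ∪ ⁅ x ⁆ ∣ ≡ suc ∣ X ∣
  card-insert {X} {x} x∉X = trans
    (weight-disjoint _ λ i i∈X → ≢⇒∉⁅⁆ x i λ { refl → ∈∉ {X = X} i∈X x∉X })
    (trans (cong (∣ X ∣ +_) (weight-⁅⁆ _ x)) (+-comm _ 1))

  -- Inclusions suffice on the left, which matters for neighbourhoods: that of an intersection may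
  -- be smaller than the intersection of the two neighbourhoods.
  card-submodular : {A B C D : Sub n} → A ⊆ C ∪ D → B ⊆ C ∩ D → ∣ A ∣ + ∣ B ∣ ≤ ∣ C ∣ + ∣ D ∣
  card-submodular {A} {B} {C} {D} p q =
    subst (∣ A ∣ + ∣ B ∣ ≤_) (weight-modular _ C D) (+-mono-≤ (card-mono p) (card-mono q))

  card-cover : {A C D : Sub n} → A ⊆ C ∪ D → ∣ A ∣ ≤ ∣ C ∣ + ∣ D ∣
  card-cover {A} p = ≤-trans (m≤m+n ∣ A ∣ ∣ ∅ {n} ∣) (card-submodular p λ _ ())

  card-disjoint : {A B C : Sub n} → (∀ i → i ∈ A → i ∉ B) → A ⊆ C → B ⊆ C → ∣ A ∣ + ∣ B ∣ ≤ ∣ C ∣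
  card-disjoint {A} {B} dis p q = subst (_≤ _) (weight-disjoint _ dis)
    (card-mono λ i r → [ p i , q i ]′ (∪⁻ A B r))

  card-remove : ∀ (A F : Sub n) y → ∣ A ∩ F ∣ ≤ ∣ A ∩ (F ∖ ⁅ y ⁆) ∣ + 1
  card-remove A F y = subst (λ k → ∣ A ∩ F ∣ ≤ ∣ A ∩ (F ∖ ⁅ y ⁆) ∣ + k) (weight-⁅⁆ _ y) (card-cover cover)
    where
    cover : A ∩ F ⊆ (A ∩ (F ∖ ⁅ y ⁆)) ∪ ⁅ y ⁆
    cover z p with q , s ← ∩⁻ A F p with mem? ⁅ y ⁆ z
    ... | inj₁ t = ∪⁺ʳ (A ∩ (F ∖ ⁅ y ⁆)) ⁅ y ⁆ t
    ... | inj₂ t = ∪⁺ˡ (A ∩ (F ∖ ⁅ y ⁆)) ⁅ y ⁆ (∩⁺ A (F ∖ ⁅ y ⁆) q (∖⁺ F ⁅ y ⁆ s t))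

  card≤n : ∀ (X : Sub n) → ∣ X ∣ ≤ n
  card≤n X = subst (∣ X ∣ ≤_) (card-all {X = λ _ → true} λ _ → refl) (card-mono λ _ _ → refl)

  card-∁ : ∀ (X : Sub n) → ∣ ∁ X ∣ + ∣ X ∣ ≤ n
  card-∁ X = ≤-trans (card-disjoint (λ i → ∁⁻ X) (λ _ _ → refl) λ _ _ → refl) (card≤n λ _ → true)

  ∈⇒≤weight : ∀ (w : Fin n → ℕ) X {i} → i ∈ X → w i ≤ weight w X
  ∈⇒≤weight w X {i} p = subst (_≤ weight w X) (weight-⁅⁆ w i)
    (weight-mono (λ j q → subst (_∈ X) (sym (⁅⁆⁻ i j q)) p) λ _ _ → ≤-refl)

  weight-subsingleton : ∀ (w : Fin n → ℕ) {X k} → (∀ i j → i ∈ X → j ∈ X → i ≡ j) →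
                        (∀ i → i ∈ X → w i ≤ k) → weight w X ≤ k
  weight-subsingleton w {X} {k} one w≤k with any? (∈? X)
  ... | yes (i , p) = ≤-trans
    (weight-mono {v = w} (λ j q → trans (cong ⁅ i ⁆ (one j i q p)) (⁅⁆⁺ i)) λ _ _ → ≤-refl)
    (≤-trans (≤-reflexive (weight-⁅⁆ w i)) (w≤k i p))
  ... | no ¬p = subst (_≤ k) (sym (weight-∅ w λ i → ¬-not λ p → ¬p (i , p))) z≤n

  nonempty : ∀ (X : Sub n) → 0 < ∣ X ∣ → ∃[ i ] i ∈ X
  nonempty X 0<X with any? (∈? X)
  ... | yes p = p
  ... | no ¬p = contradiction (subst (0 <_) (weight-∅ _ λ i → ¬-not λ p → ¬p (i , p)) 0<X) λ ()

-- The fibres of `g` are disjoint, so each element of `A` is counted at most once.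
weight-fibres : ∀ {m n} (g : Fin m → Fin n) (v : Fin m → ℕ) A (X : Sub n) →
                weight (λ y → weight v (A ∩ λ t → ⁅ g t ⁆ y)) X ≤ weight v A
weight-fibres g v A X = begin
  weight (λ y → weight v (A ∩ λ t → ⁅ g t ⁆ y)) X
    ≤⟨ weight-mono {X = X} (λ _ _ → refl) (λ _ _ → ≤-refl) ⟩
  weight (λ y → weight v (A ∩ λ t → ⁅ g t ⁆ y)) (λ _ → true)
    ≡⟨ sym (weight-comm (λ t _ → v t) A (λ t → ⁅ g t ⁆)) ⟩
  weight (λ t → weight (λ _ → v t) ⁅ g t ⁆) A
    ≤⟨ weight-mono (λ _ p → p) (λ t _ → ≤-reflexive (weight-⁅⁆ _ (g t))) ⟩
  weight v A ∎
  where open ≤-Reasoning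

-- Double counting of the pairs in `R`: each `i ∈ X` lies in at least one of them, each `j` in at
-- most one.
card-matching : ∀ {m n} {X : Sub m} (R : Fin m → Sub n) → (∀ i → i ∈ X → ∃[ j ] j ∈ R i) →
                (∀ i i′ j → i ∈ X → i′ ∈ X → j ∈ R i → j ∈ R i′ → i ≡ i′) → ∣ X ∣ ≤ n
card-matching {m} {n} {X} R matched inj = begin
  ∣ X ∣
    ≤⟨ weight-mono (λ _ p → p) (λ i p → ∈⇒≤weight (λ _ → 1) (R i) (proj₂ (matched i p))) ⟩
  weight (λ i → ∣ R i ∣) X
    ≡⟨ weight-comm _ X R ⟩
  weight (λ j → ∣ X ∩ (λ i → R i j) ∣) (λ _ → true)
    ≤⟨ weight-mono (λ _ p → p) (λ j _ → weight-subsingleton _ (one j) λ _ _ → ≤-refl) ⟩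
  ∣ (λ (_ : Fin n) → true) ∣
    ≤⟨ card≤n _ ⟩
  n ∎
  where
  open ≤-Reasoning
  one : ∀ j i i′ → i ∈ X ∩ (λ i → R i j) → i′ ∈ X ∩ (λ i → R i j) → i ≡ i′
  one j i i′ p q with p₁ , p₂ ← ∩⁻ X (λ i → R i j) p | q₁ , q₂ ← ∩⁻ X (λ i → R i j) q =
    inj i i′ j p₁ q₁ p₂ q₂

-- The search runs over Boolean vectors, and a predicate on `Fin n` agrees only pointwise with the
-- lookup of its tabulation. Hence `P` has to respect `_≗_`.
anySub? : ∀ {n} {P : Sub n → Set} → (∀ X → Dec (P X)) → (∀ {X Y} → X ≗ Y → P X → P Y) → Dec (∃ P)
anySub? P? P-resp with anySubset? (P? ∘ Vec.lookup)
... | yes (v , p) = yes (Vec.lookup v , p)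
... | no none     = no λ (X , p) → none (Vec.tabulate X , P-resp (sym ∘ lookup∘tabulate X) p)

opaque

  -- A candidate is replaced by a strictly larger one while there is one; `k` bounds the number of
  -- replacements left.
  largest : ∀ {n} {P : Sub n → Set} → (∀ X → Dec (P X)) → (∀ {X Y} → X ≗ Y → P X → P Y) →
            ∃ P → ∃[ X ] P X × (∀ Y → P Y → ∣ Y ∣ ≤ ∣ X ∣)
  largest {n} {P} P? P-resp (X , p) = go n X p (m≤n+m n ∣ X ∣)
    where
    go : ∀ k X → P X → n ≤ ∣ X ∣ + k → ∃[ X ] P X × (∀ Y → P Y → ∣ Y ∣ ≤ ∣ X ∣)
    go k X p n≤ with anySub? (λ Y → P? Y ×-dec (∣ X ∣ <? ∣ Y ∣))
                       (λ eq (q , X<Y) → P-resp eq q , subst (∣ X ∣ <_) (weight-cong _ eq) X<Y)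
    go zero X p n≤ | yes (Y , _ , X<Y) = contradiction
      (≤-trans X<Y (≤-trans (card≤n Y) (≤-trans n≤ (≤-reflexive (+-identityʳ _))))) (<-irrefl refl)
    go (suc k) X p n≤ | yes (Y , q , X<Y) = go k Y q
      (≤-trans n≤ (≤-trans (≤-reflexive (+-suc _ k)) (+-monoˡ-≤ k X<Y)))
    ... | no max = X , p , λ Y q → ≮⇒≥ λ X<Y → max (Y , q , X<Y)

-- Neighbourhoods of sets

opaque

  nb : ∀ {n} → (Fin n → Fin n → Bool) → Sub n → Sub n
  nb r X y = does (any? (λ x → ∈? (λ x → X x ∧ r x y) x))

module _ {n : ℕ} (r : Fin n → Fin n → Bool) where

  opaque
    unfolding nb

    nb⁺ : ∀ X {x y} → x ∈ X → y ∈ r x → y ∈ nb r X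
    nb⁺ X {x} p q = dec-true (any? _) (x , ∩⁺ X (λ x → r x _) p q)

    nb⁻ : ∀ X {y} → y ∈ nb r X → ∃[ x ] x ∈ X × y ∈ r x
    nb⁻ X {y} p with yes (x , q) ← any? (λ x → ∈? (λ x → X x ∧ r x y) x) = x , ∩⁻ X (λ x → r x _) q

  nb-mono : ∀ {X Y} → X ⊆ Y → nb r X ⊆ nb r Y
  nb-mono {X} {Y} X⊆Y y p with x , q , s ← nb⁻ X p = nb⁺ Y (X⊆Y x q) s

  nb-cong : ∀ {X Y} → X ≗ Y → nb r X ≗ nb r Y
  nb-cong {X} {Y} X≗Y y with mem? (nb r X) y | mem? (nb r Y) y
  ... | inj₁ p | inj₁ q = trans p (sym q)
  ... | inj₂ p | inj₂ q = trans p (sym q)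
  ... | inj₁ p | inj₂ q = ∈∉ {X = nb r Y} {y} (nb-mono (λ i s → trans (sym (X≗Y i)) s) y p) q
  ... | inj₂ p | inj₁ q = ∈∉ {X = nb r X} {y} (nb-mono (λ i s → trans (X≗Y i) s) y q) p

  nb-∪ : ∀ X Y → nb r (X ∪ Y) ⊆ nb r X ∪ nb r Y
  nb-∪ X Y y p with x , q , s ← nb⁻ (X ∪ Y) p with ∪⁻ X Y q
  ... | inj₁ q = ∪⁺ˡ (nb r X) (nb r Y) (nb⁺ X q s)
  ... | inj₂ q = ∪⁺ʳ (nb r X) (nb r Y) (nb⁺ Y q s)

-- The extension lemma

-- The family of sets on which expansion is required: bounded subsets of `V` while the inner
-- vertices are placed, all sets while the leaves are. Closure under unions is not part of it; for
-- tight sets it is established separately.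
record SmallSets (N : ℕ) : Set₁ where
  field
    Small      : Sub N → Set
    Small?     : ∀ X → Dec (Small X)
    Small-resp : ∀ {X Y} → X ≗ Y → Small X → Small Y
    Small-∅    : Small ∅
    Small-∩    : ∀ {X Y} → Small X → Small Y → Small (X ∩ Y)

module _ {N : ℕ} (r : Fin N → Fin N → Bool) (S : SmallSets N) where
  open SmallSets S

  -- Here `w` is the demand of each vertex and `F` the set of free vertices.
  Expands : (Fin N → ℕ) → Sub N → Set
  Expands w F = ∀ X → Small X → weight w X ≤ ∣ nb r X ∩ F ∣

  -- Under `Expands` the inequality is an equality: no free neighbour of `X` can be spared.
  SmallTight : (Fin N → ℕ) → Sub N → Sub N → Set
  SmallTight w F X = Small X × ∣ nb r X ∩ F ∣ ≤ weight w X

  -- By submodularity of X ↦ ∣ nb r X ∩ F ∣ the union of two tight sets is tight.  Hence a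
  -- neighbour y of x outside the neighbourhood of a largest tight set avoiding x works: a
  -- set violated after the removal of y would be tight, avoid x and be adjacent to y.
  expands-extend : ∀ {w F x} → Expands w F → 0 < w x →
    (∀ {X Y} → SmallTight w F X → SmallTight w F Y → Small (X ∪ Y)) →
    (∀ {X} → SmallTight w F X → Small (X ∪ ⁅ x ⁆)) →
    ∃[ y ] y ∈ r x × y ∈ F ×
      (∀ v → (∀ z → v z ≤ w z) → v x < w x → Expands v (F ∖ ⁅ y ⁆))
  expands-extend {w} {F} {x} exp 0<wx ∪-small ∪x-small = result
    where
    P : Sub N → Set
    P X = x ∉ X × SmallTight w F X

    P? : ∀ X → Dec (P X)
    P? X = (X x Bool.≟ false) ×-dec Small? X ×-dec (∣ nb r X ∩ F ∣ ≤? weight w X)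

    nbF-cong : ∀ {X Y} → X ≗ Y → ∣ nb r X ∩ F ∣ ≡ ∣ nb r Y ∩ F ∣
    nbF-cong eq = weight-cong _ λ z → cong (_∧ F z) (nb-cong r eq z)

    P-resp : ∀ {X Y} → X ≗ Y → P X → P Y
    P-resp eq (x∉X , sm , le) = trans (sym (eq x)) x∉X , Small-resp eq sm ,
      subst (_≤ _) (nbF-cong eq) (subst (_ ≤_) (weight-cong w eq) le)

    P-∅ : P ∅
    P-∅ = refl , Small-∅ , ≤-trans (≤-reflexive (weight-∅ _ none)) z≤n
      where
      none : ∀ z → z ∉ nb r ∅ ∩ F
      none z = ¬-not λ p → empty (nb⁻ r ∅ (proj₁ (∩⁻ (nb r ∅) F {z} p)))
        where
        empty : ¬ (∃[ u ] u ∈ ∅ × z ∈ r u)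
        empty (_ , () , _)

    max : ∃[ X ] P X × (∀ Y → P Y → ∣ Y ∣ ≤ ∣ X ∣)
    max = largest P? P-resp (∅ , P-∅)

    M : Sub N
    M = proj₁ max

    PM : P M
    PM = proj₁ (proj₂ max)

    new? : ∀ y → Dec (y ∈ r x × y ∈ F × y ∉ nb r M)
    new? y = ∈? (r x) y ×-dec ∈? F y ×-dec (nb r M y Bool.≟ false)

    ∪-tight : ∀ {X Y} → SmallTight w F X → SmallTight w F Y → ∣ nb r (X ∪ Y) ∩ F ∣ ≤ weight w (X ∪ Y)
    ∪-tight {X} {Y} (sX , tX) (sY , tY) = +-cancelʳ-≤ (weight w (X ∩ Y)) _ _ (begin
      ∣ nb r (X ∪ Y) ∩ F ∣ + weight w (X ∩ Y)       ≤⟨ +-monoʳ-≤ _ (exp (X ∩ Y) (Small-∩ sX sY)) ⟩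
      ∣ nb r (X ∪ Y) ∩ F ∣ + ∣ nb r (X ∩ Y) ∩ F ∣   ≤⟨ card-submodular ⊆∪ ⊆∩ ⟩
      ∣ nb r X ∩ F ∣ + ∣ nb r Y ∩ F ∣               ≤⟨ +-mono-≤ tX tY ⟩
      weight w X + weight w Y                       ≡⟨ sym (weight-modular w X Y) ⟩
      weight w (X ∪ Y) + weight w (X ∩ Y)           ∎)
      where
      open ≤-Reasoning
      ⊆∪ : nb r (X ∪ Y) ∩ F ⊆ (nb r X ∩ F) ∪ (nb r Y ∩ F)
      ⊆∪ z p with q , s ← ∩⁻ (nb r (X ∪ Y)) F p with ∪⁻ (nb r X) (nb r Y) (nb-∪ r X Y z q)
      ... | inj₁ t = ∪⁺ˡ (nb r X ∩ F) (nb r Y ∩ F) (∩⁺ (nb r X) F t s)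
      ... | inj₂ t = ∪⁺ʳ (nb r X ∩ F) (nb r Y ∩ F) (∩⁺ (nb r Y) F t s)
      ⊆∩ : nb r (X ∩ Y) ∩ F ⊆ (nb r X ∩ F) ∩ (nb r Y ∩ F)
      ⊆∩ z p with q , s ← ∩⁻ (nb r (X ∩ Y)) F p = ∩⁺ (nb r X ∩ F) (nb r Y ∩ F)
        (∩⁺ (nb r X) F (nb-mono r (λ i t → proj₁ (∩⁻ X Y t)) z q) s)
        (∩⁺ (nb r Y) F (nb-mono r (λ i t → proj₂ (∩⁻ X Y t)) z q) s)

    saturated : ¬ (∃[ y ] y ∈ r x × y ∈ F × y ∉ nb r M) → ∣ nb r (M ∪ ⁅ x ⁆) ∩ F ∣ ≤ ∣ nb r M ∩ F ∣
    saturated none = card-mono ⊆M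
      where
      ⊆M : nb r (M ∪ ⁅ x ⁆) ∩ F ⊆ nb r M ∩ F
      ⊆M z p with q , s ← ∩⁻ (nb r (M ∪ ⁅ x ⁆)) F p with mem? (nb r M) z
      ... | inj₁ t = ∩⁺ (nb r M) F t s
      ... | inj₂ z∉ with u , u∈ , uz ← nb⁻ r (M ∪ ⁅ x ⁆) q with ∪⁻ M ⁅ x ⁆ u∈
      ... | inj₁ u∈M = ∈∉ {X = nb r M} (nb⁺ r M u∈M uz) z∉
      ... | inj₂ u≡x with refl ← ⁅⁆⁻ x u u≡x = contradiction (z , uz , s , z∉) none

    result : ∃[ y ] y ∈ r x × y ∈ F ×
      (∀ v → (∀ z → v z ≤ w z) → v x < w x → Expands v (F ∖ ⁅ y ⁆))
    result with any? new?
    -- If all free neighbours of `x` were neighbours of `M`, adding `x` to the tight set `M` would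
    -- raise the demand by `w x > 0` without any new free neighbour.
    ... | no none = contradiction chain (<-irrefl refl)
      where
      open ≤-Reasoning
      x∉M = proj₁ PM
      chain : weight w M < weight w M
      chain = begin-strict
        weight w M                       <⟨ m<m+n _ 0<wx ⟩
        weight w M + w x                 ≡⟨ cong (weight w M +_) (sym (weight-⁅⁆ w x)) ⟩
        weight w M + weight w ⁅ x ⁆      ≡⟨ sym (weight-disjoint w λ i i∈M →
                                                  ≢⇒∉⁅⁆ x i λ { refl → ∈∉ {X = M} i∈M x∉M }) ⟩
        weight w (M ∪ ⁅ x ⁆)             ≤⟨ exp _ (∪x-small (proj₂ PM)) ⟩
        ∣ nb r (M ∪ ⁅ x ⁆) ∩ F ∣         ≤⟨ saturated none ⟩
        ∣ nb r M ∩ F ∣                   ≤⟨ proj₂ (proj₂ PM) ⟩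
        weight w M                       ∎
    ... | yes (y , y∈rx , y∈F , y∉M) = y , y∈rx , y∈F , expands
      where
      -- If `y` were a neighbour of some `z ∈ X`, then `z ∉ M`, and `X ∪ M` would be a tight set
      -- avoiding `x` and larger than `M`.
      tight-avoids-y : ∀ X → x ∉ X → SmallTight w F X → y ∉ nb r X
      tight-avoids-y X x∉X st = ¬-not λ y∈ → absurd (nb⁻ r X y∈)
        where
        absurd : ¬ (∃[ z ] z ∈ X × y ∈ r z)
        absurd (z , z∈X , y∈rz) = <-irrefl refl (begin-strict
          ∣ M ∣              <⟨ m<m+n ∣ M ∣ (s≤s z≤n) ⟩
          ∣ M ∣ + 1          ≡⟨ cong (∣ M ∣ +_) (sym (weight-⁅⁆ _ z)) ⟩
          ∣ M ∣ + ∣ ⁅ z ⁆ ∣  ≤⟨ card-disjoint dis (λ i → ∪⁺ʳ X M)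
                                  (λ i p → ∪⁺ˡ X M (subst (_∈ X) (sym (⁅⁆⁻ z i p)) z∈X)) ⟩
          ∣ X ∪ M ∣          ≤⟨ proj₂ (proj₂ max) (X ∪ M)
                                  (cong₂ _∨_ x∉X (proj₁ PM) , ∪-small st (proj₂ PM) , ∪-tight st (proj₂ PM)) ⟩
          ∣ M ∣              ∎)
          where
          open ≤-Reasoning
          dis : ∀ i → i ∈ M → i ∉ ⁅ z ⁆
          dis i i∈M = ≢⇒∉⁅⁆ z i λ { refl → ∈∉ {X = nb r M} (nb⁺ r M i∈M y∈rz) y∉M }

      expands : ∀ v → (∀ z → v z ≤ w z) → v x < w x → Expands v (F ∖ ⁅ y ⁆)
      expands v v≤w vx<wx X sX with mem? X x
      -- The removal of `y` costs at most one free neighbour, and the demand of `x` has dropped by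
      -- at least one.
      ... | inj₁ x∈X = +-cancelʳ-≤ 1 _ _ (≤-trans drop (≤-trans (exp X sX) (card-remove (nb r X) F y)))
        where
        open ≤-Reasoning
        X′ : Sub N
        X′ = X ∖ ⁅ x ⁆
        X′∌x : ∀ i → i ∈ X′ → i ∉ ⁅ x ⁆
        X′∌x i p = proj₂ (∖⁻ X ⁅ x ⁆ p)
        split : ∀ u → weight u X ≡ weight u X′ + u x
        split u = trans (weight-cong u eq)
          (trans (weight-disjoint u X′∌x) (cong (weight u X′ +_) (weight-⁅⁆ u x)))
          where
          eq : X ≗ X′ ∪ ⁅ x ⁆
          eq i with mem? ⁅ x ⁆ i
          ... | inj₁ p rewrite p | ⁅⁆⁻ x i p | x∈X = refl
          ... | inj₂ p rewrite p with X i
          ...   | true  = refl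
          ...   | false = refl
        drop : weight v X + 1 ≤ weight w X
        drop = begin
          weight v X + 1           ≡⟨ cong (_+ 1) (split v) ⟩
          weight v X′ + v x + 1    ≡⟨ +-assoc (weight v X′) (v x) 1 ⟩
          weight v X′ + (v x + 1)  ≡⟨ cong (weight v X′ +_) (+-comm (v x) 1) ⟩
          weight v X′ + suc (v x)  ≤⟨ +-mono-≤ (weight-mono (λ _ p → p) λ i _ → v≤w i) vx<wx ⟩
          weight w X′ + w x        ≡⟨ sym (split w) ⟩
          weight w X               ∎
      ... | inj₂ x∉X with ∣ nb r X ∩ F ∣ ≤? weight w X
      ... | yes tight = ≤-trans (weight-mono (λ _ p → p) λ i _ → v≤w i)
                          (≤-trans (exp X sX) (card-mono keep))
        where
        keep : nb r X ∩ F ⊆ nb r X ∩ (F ∖ ⁅ y ⁆)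
        keep z p with q , s ← ∩⁻ (nb r X) F p = ∩⁺ (nb r X) (F ∖ ⁅ y ⁆) q (∖⁺ F ⁅ y ⁆ s
          (≢⇒∉⁅⁆ y z λ { refl → ∈∉ {X = nb r X} q (tight-avoids-y X x∉X (sX , tight)) }))
      -- A set that is not tight has a free neighbour to spare.
      ... | no loose = +-cancelʳ-≤ 1 _ _ (≤-trans (≤-reflexive (+-comm _ 1))
        (≤-trans (s≤s (weight-mono (λ _ p → p) λ i _ → v≤w i))
          (≤-trans (≰⇒> loose) (card-remove (nb r X) F y))))

-- Walks and partial embeddings of trees

module _ {n : ℕ} (G : Graph n) where

  adj-comm : ∀ {a b} → b ∈ adj G a → a ∈ adj G b
  adj-comm {a} {b} p = trans (Graph.sym G b a) p

  -- Unlike `Reach`, a walk is confined to `D`, so that a vertex outside `D` can close it to a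
  -- cycle.
  data Walk (D : Sub n) : Fin n → Fin n → Set where
    stop : ∀ {a} → a ∈ D → Walk D a a
    move : ∀ {a b c} → a ∈ D → b ∈ adj G a → Walk D b c → Walk D a c

  walk-mono : ∀ {D E a b} → D ⊆ E → Walk D a b → Walk E a b
  walk-mono D⊆E (stop p)     = stop (D⊆E _ p)
  walk-mono D⊆E (move p e w) = move (D⊆E _ p) e (walk-mono D⊆E w)

  walk-snoc : ∀ {D a b c} → Walk D a b → c ∈ adj G b → c ∈ D → Walk D a c
  walk-snoc (stop p)     e q = move p e (stop q)
  walk-snoc (move p d w) e q = move p d (walk-snoc w e q)

  -- An injective sequence indexed by `Fin`, the form in which `HasCycle` expects the vertices of a
  -- cycle.
  record SimplePath (D : Sub n) (a b : Fin n) (k : ℕ) : Set where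
    field
      at     : Fin (suc k) → Fin n
      at-inj : Injective _≡_ _≡_ at
      linked : ∀ i → at (suc i) ∈ adj G (at (inject₁ i))
      start  : at zero ≡ a
      end    : at (fromℕ k) ≡ b
      inside : ∀ i → at i ∈ D
  open SimplePath

  path-cons : ∀ {D E a b c k} (p : SimplePath D b c k) → D ⊆ E → a ∈ E → b ∈ adj G a →
              (∀ i → at p i ≢ a) → SimplePath E a c (suc k)
  path-cons {a = a} p D⊆E a∈E e new = record
    { at     = λ { zero → a ; (suc i) → at p i }
    ; at-inj = λ { {zero} {zero} _ → refl
                 ; {zero} {suc j} q → contradiction (sym q) (new j)
                 ; {suc i} {zero} q → contradiction q (new i)
                 ; {suc i} {suc j} q → cong suc (at-inj p q) }
    ; linked = λ { zero → subst (_∈ adj G a) (sym (start p)) e ; (suc i) → linked p i }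
    ; start  = refl
    ; end    = end p
    ; inside = λ { zero → a∈E ; (suc i) → D⊆E _ (inside p i) }
    }

  path-suffix : ∀ {D a b k} (p : SimplePath D a b k) i → ∃[ l ] SimplePath D (at p i) b l
  path-suffix {k = k} p zero = k , record
    { at = at p ; at-inj = at-inj p ; linked = linked p ; start = refl ; end = end p ; inside = inside p }
  path-suffix {k = suc k} p (suc i) = path-suffix (record
    { at = at p ∘ suc ; at-inj = suc-injective ∘ at-inj p ; linked = linked p ∘ suc
    ; start = refl ; end = end p ; inside = inside p ∘ suc }) i

  -- Loop erasure: if the new first vertex already lies on the path, only the part of the path from
  -- there on is kept.
  walk⇒path : ∀ {D a b} → Walk D a b → ∃[ k ] SimplePath D a b k
  walk⇒path {a = a} (stop p) = 0 , record
    { at = λ _ → a ; at-inj = λ { {zero} {zero} _ → refl } ; linked = λ ()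
    ; start = refl ; end = refl ; inside = λ _ → p }
  walk⇒path {a = a} (move p e w) with _ , q ← walk⇒path w with any? (λ i → at q i ≟ a)
  ... | yes (i , refl) = path-suffix q i
  ... | no new = _ , path-cons q (λ _ → id) p e λ i r → new (i , r)

  -- Two distinct neighbours of `u` in `D` are joined by a path inside `D`, and `u` closes it to a
  -- cycle.
  unique-neighbour : ∀ {D} → ¬ HasCycle G → (∀ a b → a ∈ D → b ∈ D → Walk D a b) →
                     ∀ {u} → u ∉ D → ∀ a b → a ∈ D → b ∈ D → u ∈ adj G a → u ∈ adj G b → a ≡ b
  unique-neighbour {D} acyclic conn {u} u∉D a b a∈D b∈D au bu with a ≟ b
  ... | yes a≡b = a≡b
  ... | no a≢b with walk⇒path (conn a b a∈D b∈D)
  ...   | zero , p = contradiction (trans (sym (start p)) (end p)) a≢b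
  ...   | suc k , p = contradiction
          -- Since `a ≢ b`, the path has at least two vertices; with `u` in front there are `3 + k`,
          -- and the edge from `b` back to `u` closes the cycle.
          (k , at q , (λ {i} {j} → at-inj q {i} {j}) , linked q ,
            subst (λ z → u ∈ adj G z) (sym (end q)) bu) acyclic
    where
    q : SimplePath (λ _ → true) u b (suc (suc k))
    q = path-cons p (λ _ _ → refl) refl (adj-comm au)
          λ i r → ∈∉ {X = D} (subst (_∈ D) r (inside p i)) u∉D

  -- Along a walk from `D` to `u`, a step to a vertex outside both `D` and `Q` is followed by a step
  -- back to `D`, because such a vertex has a single neighbour. The first other step that leaves `D`
  -- therefore ends in `Q`.
  exit-edge : ∀ (Q D : Sub n) → (∀ w → w ∉ Q → ∀ a b → a ∈ adj G w → b ∈ adj G w → a ≡ b) →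
              ∀ {a u} → Reach G a u → a ∈ D → u ∈ Q → u ∉ D →
              ∃[ v ] ∃[ w ] v ∈ D × w ∈ Q × w ∉ D × w ∈ adj G v
  exit-edge Q D leaf here a∈D _ a∉D = ∈∉ {X = D} a∈D a∉D
  exit-edge Q D leaf {a} (step {w = w} aw rest) a∈D u∈Q u∉D with mem? D w | mem? Q w
  ... | inj₁ w∈D | _ = exit-edge Q D leaf rest w∈D u∈Q u∉D
  ... | inj₂ w∉D | inj₁ w∈Q = a , w , a∈D , w∈Q , w∉D , aw
  ... | inj₂ w∉D | inj₂ w∉Q with rest
  ...   | here = ∈∉ {X = Q} u∈Q w∉Q
  ...   | step {w = b} wb rest′ = exit-edge Q D leaf rest′
            (subst (_∈ D) (leaf w w∉Q a b (adj-comm aw) wb) a∈D) u∈Q u∉D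

-- Used twice: to place the inner vertices `Q` of the tree in `V`, then to place all vertices in the
-- larger host `S`.
module Embedding {n N : ℕ} (T : Graph n) (acyclic : ¬ HasCycle T) (c : EdgeColouring N)
                 (Δ : ℕ) (Q : Sub n) (host : Sub N) (S : SmallSets N) where
  open SmallSets S

  -- `need` makes the demand of a used vertex cover the neighbours still to be placed. In `capacity`
  -- a fresh vertex may demand one less than the degree, as its parent is already placed. `room`
  -- says that at most `∣ dom ∣` vertices of the host are lost; it is applied to neighbourhoods `Z`.
  record State : Set where
    field
      dom      : Sub n
      img      : Fin n → Fin N
      avail    : Sub N
      w        : Fin N → ℕ
      inhabited : ∃[ t ] t ∈ dom
      dom⊆     : dom ⊆ Q
      connected : ∀ s t → s ∈ dom → t ∈ dom → Walk T dom s t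
      img-inj  : ∀ s t → s ∈ dom → t ∈ dom → img s ≡ img t → s ≡ t
      img-edge : ∀ s t → s ∈ dom → t ∈ dom → t ∈ adj T s → img t ∈ col c (img s)
      img-host : ∀ t → t ∈ dom → img t ∈ host
      img-used : ∀ t → t ∈ dom → img t ∉ avail
      avail⊆   : avail ⊆ host
      room     : ∀ Z → ∣ Z ∩ host ∣ ≤ ∣ Z ∩ avail ∣ + ∣ dom ∣
      need     : ∀ t → t ∈ dom → ∣ adj T t ∖ dom ∣ ≤ w (img t)
      capacity : ∀ t y → t ∈ Q → t ∉ dom → y ∈ avail → ∣ adj T t ∣ ≤ suc (w y)
      w≤Δ      : ∀ y → w y ≤ Δ
      expands  : Expands (col c) S w avail
  open State

  -- The two smallness conditions that `expands-extend` requires.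
  Closed : State → Set
  Closed s = (∀ {X Y} → SmallTight (col c) S (w s) (avail s) X →
                SmallTight (col c) S (w s) (avail s) Y → Small (X ∪ Y)) ×
             (∀ {X t} → SmallTight (col c) S (w s) (avail s) X → t ∈ dom s → Small (X ∪ ⁅ img s t ⁆))

  -- The image of `u` is a free neighbour of the image of `a` supplied by `expands-extend`. As the
  -- tree is acyclic, `a` is the only neighbour of `u` in the domain, so no other edge has to be
  -- checked.
  extend : ∀ s → Closed s → ∀ {a u} → a ∈ dom s → u ∈ Q → u ∉ dom s → u ∈ adj T a →
           Σ State λ s′ → dom s′ ≡ dom s ∪ ⁅ u ⁆
  extend s (∪-small , ∪x-small) {a} {u} a∈D u∈Q u∉D au = s′ , refl
    where
    D = dom s
    D′ = D ∪ ⁅ u ⁆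
    x = img s a

    0<out : 0 < ∣ adj T a ∖ D ∣
    0<out = ∈⇒≤weight (λ _ → 1) (adj T a ∖ D) (∖⁺ (adj T a) D au u∉D)

    new : ∃[ y ] y ∈ col c x × y ∈ avail s × (∀ v → (∀ z → v z ≤ w s z) → v x < w s x →
            Expands (col c) S v (avail s ∖ ⁅ y ⁆))
    new = expands-extend (col c) S (expands s) (<-≤-trans 0<out (need s a a∈D)) ∪-small
            λ st → ∪x-small st a∈D

    y = proj₁ new
    xy = proj₁ (proj₂ new)
    y∈F = proj₁ (proj₂ (proj₂ new))
    F′ = avail s ∖ ⁅ y ⁆

    f′ : Fin n → Fin N
    f′ t = if ⁅ u ⁆ t then y else img s t

    -- One of the neighbours that `x` demanded has now been found.
    w′ : Fin N → ℕ
    w′ z = if ⁅ x ⁆ z then pred (w s z) else w s z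

    w′≤w : ∀ z → w′ z ≤ w s z
    w′≤w z with ⁅ x ⁆ z
    ... | true  = pred[n]≤n
    ... | false = ≤-refl

    w′x : w′ x ≡ pred (w s x)
    w′x rewrite ⁅⁆⁺ x = refl

    w′-other : ∀ z → z ≢ x → w′ z ≡ w s z
    w′-other z z≢x rewrite ≢⇒∉⁅⁆ x z z≢x = refl

    0<wx : 0 < w s x
    0<wx = <-≤-trans 0<out (need s a a∈D)

    ≢u : ∀ {t} → t ∈ D → t ≢ u
    ≢u t∈D refl = ∈∉ {X = D} t∈D u∉D

    avail≢img : ∀ {z t} → z ∈ avail s → t ∈ D → z ≢ img s t
    avail≢img {z} z∈F t∈D refl = ∈∉ {X = avail s} z∈F (img-used s _ t∈D)

    f′-old : ∀ t → t ∈ D → f′ t ≡ img s t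
    f′-old t t∈D rewrite ≢⇒∉⁅⁆ u t (≢u t∈D) = refl

    f′-new : f′ u ≡ y
    f′-new rewrite ⁅⁆⁺ u = refl

    D′-elim : ∀ (P : Fin n → Set) → (∀ t → t ∈ D → P t) → P u → ∀ t → t ∈ D′ → P t
    D′-elim P old new t t∈ with ∪⁻ D ⁅ u ⁆ {t} t∈
    ... | inj₁ t∈D = old t t∈D
    ... | inj₂ t∈u = subst P (sym (⁅⁆⁻ u t t∈u)) new

    D⊆D′ : D ⊆ D′
    D⊆D′ t = ∪⁺ˡ D ⁅ u ⁆

    u∈D′ : u ∈ D′
    u∈D′ = ∪⁺ʳ D ⁅ u ⁆ (⁅⁆⁺ u)

    unique : ∀ t → t ∈ D → u ∈ adj T t → t ≡ a
    unique t t∈D tu = unique-neighbour T acyclic (connected s) u∉D t a t∈D a∈D tu au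

    connected′ : ∀ t t′ → t ∈ D′ → t′ ∈ D′ → Walk T D′ t t′
    connected′ t t′ p = D′-elim (λ t → ∀ t′ → t′ ∈ D′ → Walk T D′ t t′)
      (λ t q → D′-elim (Walk T D′ t) (λ t′ q′ → walk-mono T D⊆D′ (connected s t t′ q q′))
        (walk-snoc T (walk-mono T D⊆D′ (connected s t a q a∈D)) au u∈D′))
      (D′-elim (Walk T D′ u)
        (λ t′ q′ → move u∈D′ (adj-comm T au) (walk-mono T D⊆D′ (connected s a t′ a∈D q′)))
        (stop u∈D′)) t p t′

    inj′ : ∀ t t′ → t ∈ D′ → t′ ∈ D′ → f′ t ≡ f′ t′ → t ≡ t′
    inj′ t t′ p = D′-elim (λ t → ∀ t′ → t′ ∈ D′ → f′ t ≡ f′ t′ → t ≡ t′)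
      (λ t q → D′-elim (λ t′ → f′ t ≡ f′ t′ → t ≡ t′)
        (λ t′ q′ e → img-inj s t t′ q q′ (trans (sym (f′-old t q)) (trans e (f′-old t′ q′))))
        λ e → contradiction (trans (sym f′-new) (trans (sym e) (f′-old t q))) (avail≢img y∈F q))
      (D′-elim (λ t′ → f′ u ≡ f′ t′ → u ≡ t′)
        (λ t′ q′ e → contradiction (trans (sym f′-new) (trans e (f′-old t′ q′))) (avail≢img y∈F q′))
        λ _ → refl) t p t′

    edge′ : ∀ t t′ → t ∈ D′ → t′ ∈ D′ → t′ ∈ adj T t → f′ t′ ∈ col c (f′ t)
    edge′ t t′ p = D′-elim (λ t → ∀ t′ → t′ ∈ D′ → t′ ∈ adj T t → f′ t′ ∈ col c (f′ t))
      (λ t q → D′-elim (λ t′ → t′ ∈ adj T t → f′ t′ ∈ col c (f′ t))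
        (λ t′ q′ e → trans (cong₂ (col c) (f′-old t q) (f′-old t′ q′)) (img-edge s t t′ q q′ e))
        (toNew t q))
      (D′-elim (λ t′ → t′ ∈ adj T u → f′ t′ ∈ col c (f′ u))
        (λ t′ q′ e → trans (colSym c _ _) (toNew t′ q′ (adj-comm T e)))
        λ e → ∈∉ {X = adj T u} e (irrefl T u)) t p t′
      where
      toNew : ∀ t → t ∈ D → u ∈ adj T t → f′ u ∈ col c (f′ t)
      toNew t q e with refl ← unique t q e = trans (cong₂ (col c) (f′-old t q) f′-new) xy

    shrink : ∀ t → ∣ adj T t ∖ D′ ∣ ≤ ∣ adj T t ∖ D ∣
    shrink t = card-mono λ v p → ∖⁺ (adj T t) D (proj₁ (∖⁻ (adj T t) D′ p))
      (¬-not λ q → ∈∉ {X = D′} (D⊆D′ v q) (proj₂ (∖⁻ (adj T t) D′ p)))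

    -- Applied to the parent `a` with `v = u`, where it matches the drop of the demand, and to `u`
    -- with `v = a`, where it matches the successor in `capacity`.
    lose : ∀ t X {v} → v ∈ X → v ∈ D′ → adj T t ∖ D′ ⊆ X → suc ∣ adj T t ∖ D′ ∣ ≤ ∣ X ∣
    lose t X {v} v∈X v∈D′ sub = ≤-trans (≤-reflexive (trans (+-comm 1 _)
        (cong (∣ adj T t ∖ D′ ∣ +_) (sym (weight-⁅⁆ _ v)))))
      (card-disjoint (λ z p → ≢⇒∉⁅⁆ v z λ { refl → ∈∉ {X = D′} v∈D′ (proj₂ (∖⁻ (adj T t) D′ p)) })
        sub λ z p → subst (_∈ X) (sym (⁅⁆⁻ v z p)) v∈X)

    need-old : ∀ t → t ∈ D → ∣ adj T t ∖ D′ ∣ ≤ w′ (img s t)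
    need-old t t∈D with t ≟ a
    ... | no t≢a = ≤-trans (shrink t) (subst (∣ adj T t ∖ D ∣ ≤_)
      (sym (w′-other (img s t) (t≢a ∘ img-inj s t a t∈D a∈D))) (need s t t∈D))
    ... | yes refl = subst (∣ adj T a ∖ D′ ∣ ≤_) (sym w′x) (pred-mono-≤ (≤-trans
      (lose a (adj T a ∖ D) (∖⁺ (adj T a) D au u∉D) u∈D′ sub) (need s a a∈D)))
      where
      sub : adj T a ∖ D′ ⊆ adj T a ∖ D
      sub v p = ∖⁺ (adj T a) D (proj₁ (∖⁻ (adj T a) D′ p))
        (¬-not λ q → ∈∉ {X = D′} (D⊆D′ v q) (proj₂ (∖⁻ (adj T a) D′ p)))

    need-new : ∣ adj T u ∖ D′ ∣ ≤ w′ y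
    need-new = subst (∣ adj T u ∖ D′ ∣ ≤_) (sym (w′-other y (avail≢img y∈F a∈D)))
      (≤-pred (≤-trans (lose u (adj T u) (adj-comm T au) (D⊆D′ a a∈D) λ v p → proj₁ (∖⁻ (adj T u) D′ p))
        (capacity s u y u∈Q u∉D y∈F)))

    room′ : ∀ Z → ∣ Z ∩ host ∣ ≤ ∣ Z ∩ F′ ∣ + ∣ D′ ∣
    room′ Z = begin
      ∣ Z ∩ host ∣                       ≤⟨ room s Z ⟩
      ∣ Z ∩ avail s ∣ + ∣ D ∣            ≤⟨ +-monoˡ-≤ _ (card-remove Z (avail s) y) ⟩
      ∣ Z ∩ F′ ∣ + 1 + ∣ D ∣             ≡⟨ +-assoc ∣ Z ∩ F′ ∣ 1 _ ⟩
      ∣ Z ∩ F′ ∣ + suc ∣ D ∣             ≡⟨ cong (∣ Z ∩ F′ ∣ +_) (sym (card-insert u∉D)) ⟩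
      ∣ Z ∩ F′ ∣ + ∣ D′ ∣                ∎
      where open ≤-Reasoning

    F′⊆ : ∀ {z} → z ∈ F′ → z ∈ avail s
    F′⊆ p = proj₁ (∖⁻ (avail s) ⁅ y ⁆ p)

    s′ : State
    s′ = record
      { dom = D′ ; img = f′ ; avail = F′ ; w = w′
      ; inhabited = u , u∈D′
      ; dom⊆ = D′-elim (_∈ Q) (dom⊆ s) u∈Q
      ; connected = connected′
      ; img-inj = inj′
      ; img-edge = edge′
      ; img-host = D′-elim (λ t → f′ t ∈ host)
          (λ t q → subst (_∈ host) (sym (f′-old t q)) (img-host s t q))
          (subst (_∈ host) (sym f′-new) (avail⊆ s y y∈F))
      ; img-used = D′-elim (λ t → f′ t ∉ F′)
          (λ t q → subst (_∉ F′) (sym (f′-old t q))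
            (¬-not λ p → ∈∉ {X = avail s} (F′⊆ p) (img-used s t q)))
          (subst (_∉ F′) (sym f′-new) (¬-not λ p → ∈∉ {X = ⁅ y ⁆} {y} (⁅⁆⁺ y) (proj₂ (∖⁻ (avail s) ⁅ y ⁆ p))))
      ; avail⊆ = λ z p → avail⊆ s z (F′⊆ p)
      ; room = room′
      ; need = D′-elim (λ t → ∣ adj T t ∖ D′ ∣ ≤ w′ (f′ t))
          (λ t q → subst (λ z → ∣ adj T t ∖ D′ ∣ ≤ w′ z) (sym (f′-old t q)) (need-old t q))
          (subst (λ z → ∣ adj T u ∖ D′ ∣ ≤ w′ z) (sym f′-new) need-new)
      ; capacity = λ t z t∈Q t∉D′ z∈F′ → subst (λ k → ∣ adj T t ∣ ≤ suc k)
          (sym (w′-other z (avail≢img (F′⊆ z∈F′) a∈D)))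
          (capacity s t z t∈Q (¬-not λ q → ∈∉ {X = D′} (D⊆D′ t q) t∉D′) (F′⊆ z∈F′))
      ; w≤Δ = λ z → ≤-trans (w′≤w z) (w≤Δ s z)
      ; expands = proj₂ (proj₂ (proj₂ new)) w′ w′≤w (subst (_< w s x) (sym w′x) (pred-< 0<wx))
      }
      where
      pred-< : ∀ {k} → 0 < k → pred k < k
      pred-< (s≤s _) = ≤-refl

  complete : (∀ s → Closed s) → (∀ a b → Reach T a b) →
             (∀ v → v ∉ Q → ∀ a b → a ∈ adj T v → b ∈ adj T v → a ≡ b) →
             State → Σ State λ s → Q ⊆ dom s
  complete closed reach leaf s₀ = go n s₀ (m≤n+m n ∣ dom s₀ ∣)
    where
    -- Each extension adds one vertex to the domain, so `k` bounds the number of steps left.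
    go : ∀ k s → n ≤ ∣ dom s ∣ + k → Σ State λ s → Q ⊆ dom s
    go k s n≤ with any? (λ u → ∈? Q u ×-dec (dom s u Bool.≟ false))
    go k s n≤ | no none = s , λ u u∈Q → ¬-not λ u∉D → none (u , u∈Q , u∉D)
    go k s n≤ | yes (u , u∈Q , u∉D)
      with a , v , a∈D , v∈Q , v∉D , av ←
        exit-edge T Q (dom s) leaf (reach (proj₁ (inhabited s)) u) (proj₂ (inhabited s)) u∈Q u∉D
      with s′ , dom≡ ← extend s (closed s) a∈D v∈Q v∉D av = next k n≤
      where
      grown : ∣ dom s′ ∣ ≡ suc ∣ dom s ∣
      grown = trans (cong ∣_∣ dom≡) (card-insert v∉D)
      next : ∀ k → n ≤ ∣ dom s ∣ + k → Σ State λ s → Q ⊆ dom s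
      next zero    n≤ = contradiction (≤-trans (≤-trans (≤-reflexive (sym grown)) (card≤n (dom s′)))
        (≤-trans n≤ (≤-reflexive (+-identityʳ _)))) (<-irrefl refl)
      next (suc k) n≤ = go k s′ (≤-trans n≤ (≤-reflexive (trans (+-suc _ k) (cong (_+ k) (sym grown)))))

-- Embedding a tree with many leaves

two-elements : ∀ {n} {X : Sub n} → ∣ X ∣ ≤ 1 → ∀ a b → a ∈ X → b ∈ X → a ≡ b
two-elements {X = X} X≤1 a b a∈X b∈X with a ≟ b
... | yes a≡b = a≡b
... | no a≢b = contradiction (≤-trans (≤-reflexive (sym (cong₂ _+_ (weight-⁅⁆ _ a) (weight-⁅⁆ _ b))))
  (≤-trans (card-disjoint dis (λ i p → subst (_∈ X) (sym (⁅⁆⁻ a i p)) a∈X)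
                              (λ i p → subst (_∈ X) (sym (⁅⁆⁻ b i p)) b∈X)) X≤1)) λ { (s≤s ()) }
  where
  dis : ∀ i → i ∈ ⁅ a ⁆ → i ∉ ⁅ b ⁆
  dis i p = ≢⇒∉⁅⁆ b i λ q → a≢b (trans (sym (⁅⁆⁻ a i p)) q)

allSets : ∀ N → SmallSets N
allSets N = record
  { Small = λ _ → ⊤ ; Small? = λ _ → yes tt ; Small-resp = λ _ _ → tt ; Small-∅ = tt ; Small-∩ = λ _ _ → tt }

boundedSets : ∀ {N} → Sub N → ℕ → SmallSets N
boundedSets V k = record
  { Small      = λ X → X ⊆ V × ∣ X ∣ ≤ k
  ; Small?     = λ X → all? (λ i → ∈? X i →-dec ∈? V i) ×-dec (∣ X ∣ ≤? k)
  ; Small-resp = λ eq (X⊆V , X≤k) → (λ i p → X⊆V i (trans (eq i) p)) , subst (_≤ k) (weight-cong _ eq) X≤k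
  ; Small-∅    = (λ _ ()) , ≤-trans (≤-reflexive (weight-∅ _ λ _ → refl)) z≤n
  ; Small-∩    = λ {X} {Y} (X⊆V , X≤k) _ →
      (λ i p → X⊆V i (proj₁ (∩⁻ X Y p))) , ≤-trans (card-mono λ i p → proj₁ (∩⁻ X Y p)) X≤k
  }

-- `M` stands for the order of `H`.
module _ {n N : ℕ} (T : Graph n) (c : EdgeColouring N) (Δ M : ℕ) (root : Fin n)
         (acyclic : ¬ HasCycle T) (reach : ∀ a b → Reach T a b)
         (deg≤Δ : ∀ v → ∣ adj T v ∣ ≤ Δ) (1≤Δ : 1 ≤ Δ) where

  leaf : Sub n
  leaf v = does (∣ adj T v ∣ ℕ.≟ 1)

  leaf⁻ : ∀ v → v ∈ leaf → ∣ adj T v ∣ ≡ 1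
  leaf⁻ v p = ≡ᵇ⇒≡ ∣ adj T v ∣ 1 (subst IsTrue (sym p) tt)

  -- The embedding starts at `root`, which may be a leaf and is therefore added; this accounts for
  -- the extra one in `inner+leaves≤`.
  inner : Sub n
  inner = ∁ leaf ∪ ⁅ root ⁆

  ∉inner⇒leaf : ∀ v → v ∉ inner → ∣ adj T v ∣ ≡ 1
  ∉inner⇒leaf v v∉ = leaf⁻ v (trans (sym (Bool.not-involutive (leaf v)))
    (cong not (Bool.∨-conicalˡ (∁ leaf v) _ v∉)))

  module _ (many-leaves : 13 * (Δ * M) + 1 ≤ ∣ leaf ∣) (S : Sub N) (n≤S : n ≤ ∣ S ∣)
           (expanding : ∀ X → X ⊆ S → M ≤ ∣ X ∣ → n ≤ ∣ (X ∪ nb (col c) X) ∩ S ∣) where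

    private
      Γ : Sub N → Sub N
      Γ = nb (col c)

      p : ℕ
      p = Δ * M

      M≤p : M ≤ p
      M≤p = ≤-trans (≤-reflexive (sym (*-identityˡ M))) (*-monoˡ-≤ M 1≤Δ)

      13p<n : 13 * p < n
      13p<n = ≤-trans (≤-trans (≤-reflexive (+-comm 1 (13 * p))) many-leaves) (card≤n leaf)

      -- The bound `2 * M` lets a bad set with fewer than `M` elements be united with another set of
      -- fewer than `M` elements.
      Bad : Sub N → Set
      Bad B = B ⊆ S × ∣ B ∣ ≤ 2 * M × ∣ Γ B ∩ (S ∖ B) ∣ ≤ Δ * ∣ B ∣

      Bad? : ∀ B → Dec (Bad B)
      Bad? B = all? (λ i → ∈? B i →-dec ∈? S i) ×-dec (∣ B ∣ ≤? 2 * M) ×-dec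
               (∣ Γ B ∩ (S ∖ B) ∣ ≤? Δ * ∣ B ∣)

      Bad-resp : ∀ {X Y} → X ≗ Y → Bad X → Bad Y
      Bad-resp {X} {Y} eq (X⊆S , X≤ , ΓX≤) = (λ i q → X⊆S i (trans (eq i) q)) , subst (_≤ 2 * M) ∣eq∣ X≤ ,
        subst (λ k → _ ≤ Δ * k) ∣eq∣ (subst (_≤ Δ * ∣ X ∣)
          (weight-cong _ λ z → cong₂ _∧_ (nb-cong (col c) eq z) (cong (λ b → S z ∧ not b) (eq z))) ΓX≤)
        where
        ∣eq∣ : ∣ X ∣ ≡ ∣ Y ∣
        ∣eq∣ = weight-cong _ eq

      Bad-∅ : Bad ∅
      Bad-∅ = (λ _ ()) , ≤-trans (≤-reflexive (weight-∅ _ λ _ → refl)) z≤n ,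
        ≤-trans (≤-reflexive (weight-∅ _ λ z → ¬-not λ q →
          empty z (nb⁻ (col c) ∅ (proj₁ (∩⁻ (Γ ∅) (S ∖ ∅) {z} q))))) z≤n
        where
        empty : ∀ z → ¬ (∃[ u ] u ∈ ∅ × z ∈ col c u)
        empty _ (_ , () , _)

      biggest : ∃[ B ] Bad B × (∀ Y → Bad Y → ∣ Y ∣ ≤ ∣ B ∣)
      biggest = largest Bad? Bad-resp (∅ , Bad-∅)

      B : Sub N
      B = proj₁ biggest

      B⊆S = proj₁ (proj₁ (proj₂ biggest))
      B≤2M = proj₁ (proj₂ (proj₁ (proj₂ biggest)))
      ΓB≤ = proj₂ (proj₂ (proj₁ (proj₂ biggest)))

      4p≤13p : 2 * p + 2 * p ≤ 13 * p
      4p≤13p = ≤-trans (≤-reflexive (sym (*-distribʳ-+ p 2 2)))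
        (*-monoˡ-≤ p {4} {13} (s≤s (s≤s (s≤s (s≤s z≤n)))))

      Δ*≤2p : ∀ {k} → k ≤ 2 * M → Δ * k ≤ 2 * p
      Δ*≤2p {k} k≤ = begin
        Δ * k        ≤⟨ *-monoʳ-≤ Δ k≤ ⟩
        Δ * (2 * M)  ≡⟨ sym (*-assoc Δ 2 M) ⟩
        Δ * 2 * M    ≡⟨ cong (_* M) (*-comm Δ 2) ⟩
        2 * Δ * M    ≡⟨ *-assoc 2 Δ M ⟩
        2 * p        ∎
        where open ≤-Reasoning

      -- Otherwise `expanding` applies to `B`, but `B` and its neighbours in `S` number at most
      -- `2 * M + 2 * p ≤ 4 * p`, which is less than `n`.
      B<M : ∣ B ∣ < M
      B<M = ≰⇒> λ M≤B → <-irrefl refl (begin-strict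
        13 * p                          <⟨ 13p<n ⟩
        n                               ≤⟨ expanding B B⊆S M≤B ⟩
        ∣ (B ∪ Γ B) ∩ S ∣               ≤⟨ card-cover cover ⟩
        ∣ B ∣ + ∣ Γ B ∩ (S ∖ B) ∣       ≤⟨ +-mono-≤ B≤2M (≤-trans ΓB≤ (Δ*≤2p B≤2M)) ⟩
        2 * M + 2 * p                   ≤⟨ +-monoˡ-≤ _ (*-monoʳ-≤ 2 M≤p) ⟩
        2 * p + 2 * p                   ≤⟨ 4p≤13p ⟩
        13 * p                          ∎)
        where
        open ≤-Reasoning
        cover : (B ∪ Γ B) ∩ S ⊆ B ∪ (Γ B ∩ (S ∖ B))
        cover z z∈ with q , z∈S ← ∩⁻ (B ∪ Γ B) S z∈ with mem? B z
        ... | inj₁ z∈B = ∪⁺ˡ B (Γ B ∩ (S ∖ B)) z∈B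
        ... | inj₂ z∉B with ∪⁻ B (Γ B) q
        ... | inj₁ z∈B = ∪⁺ˡ B (Γ B ∩ (S ∖ B)) z∈B
        ... | inj₂ z∈Γ = ∪⁺ʳ B (Γ B ∩ (S ∖ B)) (∩⁺ (Γ B) (S ∖ B) z∈Γ (∖⁺ S B z∈S z∉B))

      1≤p : 1 ≤ p
      1≤p = ≤-trans (≤-trans (s≤s z≤n) B<M) M≤p

      V : Sub N
      V = S ∖ B

      S-split : ∀ {z} → z ∈ S → z ∈ V ⊎ z ∈ B
      S-split {z} z∈S with mem? B z
      ... | inj₁ z∈B = inj₂ z∈B
      ... | inj₂ z∉B = inj₁ (∖⁺ S B z∈S z∉B)

      V⊆S : V ⊆ S
      V⊆S z q = proj₁ (∖⁻ S B q)

      -- Of the `n` vertices given by `expanding`, those missing from `Γ X ∩ V` lie in `B` or `X`,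
      -- hence number at most `3 * M`.
      large-expands : ∀ X → X ⊆ V → M ≤ ∣ X ∣ → ∣ X ∣ ≤ 2 * M → n ≤ ∣ Γ X ∩ V ∣ + 3 * p
      large-expands X X⊆V M≤X X≤2M = begin
        n                                     ≤⟨ expanding X (λ z q → V⊆S z (X⊆V z q)) M≤X ⟩
        ∣ (X ∪ Γ X) ∩ S ∣                     ≤⟨ card-cover cover ⟩
        ∣ Γ X ∩ V ∣ + ∣ B ∪ X ∣               ≤⟨ +-monoʳ-≤ _ (card-cover {A = B ∪ X} λ _ → id) ⟩
        ∣ Γ X ∩ V ∣ + (∣ B ∣ + ∣ X ∣)         ≤⟨ +-monoʳ-≤ (∣ Γ X ∩ V ∣) (+-mono-≤ (<⇒≤ B<M) X≤2M) ⟩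
        ∣ Γ X ∩ V ∣ + 3 * M                   ≤⟨ +-monoʳ-≤ (∣ Γ X ∩ V ∣) (*-monoʳ-≤ 3 M≤p) ⟩
        ∣ Γ X ∩ V ∣ + 3 * p                   ∎
        where
        open ≤-Reasoning
        cover : (X ∪ Γ X) ∩ S ⊆ (Γ X ∩ V) ∪ (B ∪ X)
        cover z z∈ with q , z∈S ← ∩⁻ (X ∪ Γ X) S z∈ with ∪⁻ X (Γ X) q | S-split z∈S
        ... | inj₁ z∈X | _ = ∪⁺ʳ (Γ X ∩ V) (B ∪ X) (∪⁺ʳ B X z∈X)
        ... | inj₂ _ | inj₂ z∈B = ∪⁺ʳ (Γ X ∩ V) (B ∪ X) (∪⁺ˡ B X z∈B)
        ... | inj₂ z∈Γ | inj₁ z∈V = ∪⁺ˡ (Γ X ∩ V) (B ∪ X) (∩⁺ (Γ X) V z∈Γ z∈V)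

      -- If X does not expand in V then B ∪ X is bad.
      small-expands : ∀ X → X ⊆ V → ∣ X ∣ < M → ∣ Γ X ∩ V ∣ ≤ Δ * ∣ X ∣ → ∣ X ∣ ≡ 0
      small-expands X X⊆V X<M ΓX≤ = n≤0⇒n≡0 (+-cancelˡ-≤ ∣ B ∣ _ _ (begin
        ∣ B ∣ + ∣ X ∣   ≡⟨ sym ∣B∪X∣ ⟩
        ∣ B ∪ X ∣       ≤⟨ proj₂ (proj₂ biggest) (B ∪ X) (B∪X⊆S , B∪X≤2M , ΓB∪X≤) ⟩
        ∣ B ∣           ≡⟨ sym (+-identityʳ ∣ B ∣) ⟩
        ∣ B ∣ + 0       ∎))
        where
        open ≤-Reasoning
        ∣B∪X∣ : ∣ B ∪ X ∣ ≡ ∣ B ∣ + ∣ X ∣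
        ∣B∪X∣ = weight-disjoint _ λ i i∈B → ¬-not λ i∈X → ∈∉ {X = B} i∈B (proj₂ (∖⁻ S B (X⊆V i i∈X)))
        B∪X⊆S : B ∪ X ⊆ S
        B∪X⊆S i q = [ B⊆S i , V⊆S i ∘ X⊆V i ]′ (∪⁻ B X q)
        B∪X≤2M : ∣ B ∪ X ∣ ≤ 2 * M
        B∪X≤2M = subst (_≤ 2 * M) (sym ∣B∪X∣) (≤-trans (+-mono-≤ (<⇒≤ B<M) (<⇒≤ X<M))
          (≤-reflexive (cong (M +_) (sym (+-identityʳ M)))))
        cover : Γ (B ∪ X) ∩ (S ∖ (B ∪ X)) ⊆ (Γ B ∩ V) ∪ (Γ X ∩ V)
        cover z q with z∈Γ , z∈ ← ∩⁻ (Γ (B ∪ X)) (S ∖ (B ∪ X)) q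
          with z∈S , z∉ ← ∖⁻ S (B ∪ X) z∈ with ∪⁻ (Γ B) (Γ X) (nb-∪ (col c) B X z z∈Γ)
        ... | inj₁ s = ∪⁺ˡ (Γ B ∩ V) (Γ X ∩ V) (∩⁺ (Γ B) V s (∖⁺ S B z∈S (Bool.∨-conicalˡ (B z) _ z∉)))
        ... | inj₂ s = ∪⁺ʳ (Γ B ∩ V) (Γ X ∩ V) (∩⁺ (Γ X) V s (∖⁺ S B z∈S (Bool.∨-conicalˡ (B z) _ z∉)))
        ΓB∪X≤ : ∣ Γ (B ∪ X) ∩ (S ∖ (B ∪ X)) ∣ ≤ Δ * ∣ B ∪ X ∣
        ΓB∪X≤ = begin
          ∣ Γ (B ∪ X) ∩ (S ∖ (B ∪ X)) ∣   ≤⟨ card-cover cover ⟩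
          ∣ Γ B ∩ V ∣ + ∣ Γ X ∩ V ∣       ≤⟨ +-mono-≤ ΓB≤ ΓX≤ ⟩
          Δ * ∣ B ∣ + Δ * ∣ X ∣           ≡⟨ sym (*-distribˡ-+ Δ (∣ B ∣) (∣ X ∣)) ⟩
          Δ * (∣ B ∣ + ∣ X ∣)             ≡⟨ cong (Δ *_) (sym ∣B∪X∣) ⟩
          Δ * ∣ B ∪ X ∣                   ∎

      -- Tight sets will turn out to have fewer than `M` elements, so the union of two of them stays
      -- within `2 * M`.
      bounded : SmallSets N
      bounded = boundedSets V (2 * M)

      module Inner = Embedding T acyclic c Δ inner V bounded
      module Whole = Embedding T acyclic c Δ (λ _ → true) S (allSets N)

      V-point : ∃[ y ] y ∈ V
      V-point = nonempty V (+-cancelʳ-< _ 0 _ (begin-strict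
        ∣ B ∣          <⟨ B<M ⟩
        M              ≤⟨ ≤-trans M≤p (m≤n*m p 13) ⟩
        13 * p         ≤⟨ <⇒≤ 13p<n ⟩
        n              ≤⟨ n≤S ⟩
        ∣ S ∣          ≤⟨ card-cover (λ z q → [ ∪⁺ˡ V B , ∪⁺ʳ V B ]′ (S-split q)) ⟩
        ∣ V ∣ + ∣ B ∣  ∎))
        where open ≤-Reasoning

      -- Only `root` is placed, and every vertex demands `Δ`. Expansion comes from `small-expands`
      -- below `M` and from `large-expands` between `M` and `2 * M`.
      initial : Inner.State
      initial = record
        { dom = ⁅ root ⁆ ; img = λ _ → y ; avail = V ∖ ⁅ y ⁆ ; w = λ _ → Δ
        ; inhabited = root , ⁅⁆⁺ root
        ; dom⊆ = λ t t≡ → ∪⁺ʳ (∁ leaf) ⁅ root ⁆ t≡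
        ; connected = λ s t s≡ t≡ → subst (Walk T ⁅ root ⁆ s) (same s t s≡ t≡) (stop s≡)
        ; img-inj = λ s t s≡ t≡ _ → same s t s≡ t≡
        ; img-edge = λ s t s≡ t≡ e → ∈∉ {X = adj T s} e (subst (_∉ adj T s) (same s t s≡ t≡) (irrefl T s))
        ; img-host = λ _ _ → y∈V
        ; img-used = λ _ _ → ¬-not λ q → ∈∉ {X = ⁅ y ⁆} {y} (⁅⁆⁺ y) (proj₂ (∖⁻ V ⁅ y ⁆ q))
        ; avail⊆ = λ z q → proj₁ (∖⁻ V ⁅ y ⁆ q)
        ; room = λ Z → ≤-trans (card-remove Z V y) (+-monoʳ-≤ _ (≤-reflexive (sym (weight-⁅⁆ _ root))))
        ; need = λ t _ → ≤-trans (card-mono λ v q → proj₁ (∖⁻ (adj T t) ⁅ root ⁆ q)) (deg≤Δ t)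
        ; capacity = λ t _ _ _ _ → m≤n⇒m≤1+n (deg≤Δ t)
        ; w≤Δ = λ _ → ≤-refl
        ; expands = λ X (X⊆V , X≤2M) →
            subst (_≤ ∣ Γ X ∩ (V ∖ ⁅ y ⁆) ∣) (sym (weight-const Δ X)) (expands₀ X X⊆V X≤2M)
        }
        where
        y = proj₁ V-point
        y∈V = proj₂ V-point
        same : ∀ s t → s ∈ ⁅ root ⁆ → t ∈ ⁅ root ⁆ → s ≡ t
        same s t s≡ t≡ = trans (⁅⁆⁻ root s s≡) (sym (⁅⁆⁻ root t t≡))
        expands₀ : ∀ X → X ⊆ V → ∣ X ∣ ≤ 2 * M → Δ * ∣ X ∣ ≤ ∣ Γ X ∩ (V ∖ ⁅ y ⁆) ∣
        expands₀ X X⊆V X≤2M with ∣ Γ X ∩ V ∣ ≤? Δ * ∣ X ∣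
        -- There are more than `Δ * ∣ X ∣` neighbours in `V`, and the surplus pays for `y`.
        ... | no more = +-cancelʳ-≤ 1 _ _ (≤-trans (≤-reflexive (+-comm _ 1))
                          (≤-trans (≰⇒> more) (card-remove (Γ X) V y)))
        ... | yes few with M ≤? ∣ X ∣
        ...   | no X<M = subst (_≤ ∣ Γ X ∩ (V ∖ ⁅ y ⁆) ∣)
                  (sym (trans (cong (Δ *_) (small-expands X X⊆V (≰⇒> X<M) few)) (*-zeroʳ Δ))) z≤n
        ...   | yes M≤X = contradiction (begin-strict
          13 * p                 <⟨ 13p<n ⟩
          n                      ≤⟨ large-expands X X⊆V M≤X X≤2M ⟩
          ∣ Γ X ∩ V ∣ + 3 * p    ≤⟨ +-monoˡ-≤ _ (≤-trans few (Δ*≤2p X≤2M)) ⟩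
          2 * p + 3 * p          ≡⟨ sym (*-distribʳ-+ p 2 3) ⟩
          5 * p                  ≤⟨ *-monoˡ-≤ p {5} {13} (s≤s (s≤s (s≤s (s≤s (s≤s z≤n))))) ⟩
          13 * p                 ∎) (<-irrefl refl)
          where open ≤-Reasoning

      inner+leaves≤ : ∣ inner ∣ + ∣ leaf ∣ ≤ n + 1
      inner+leaves≤ = begin
        ∣ inner ∣ + ∣ leaf ∣                  ≤⟨ +-monoˡ-≤ _ (card-cover {A = inner} λ _ → id) ⟩
        ∣ ∁ leaf ∣ + ∣ ⁅ root ⁆ ∣ + ∣ leaf ∣  ≡⟨ cong (λ k → ∣ ∁ leaf ∣ + k + ∣ leaf ∣) (weight-⁅⁆ _ root) ⟩
        ∣ ∁ leaf ∣ + 1 + ∣ leaf ∣             ≡⟨ solve 2 (λ i l → i :+ con 1 :+ l := i :+ l :+ con 1) refl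
                                                   (∣ ∁ leaf ∣) (∣ leaf ∣) ⟩
        ∣ ∁ leaf ∣ + ∣ leaf ∣ + 1             ≤⟨ +-monoˡ-≤ 1 (card-∁ leaf) ⟩
        n + 1                                 ∎
        where
        open ≤-Reasoning
        open +-*-Solver

      -- Suppose `∣ X ∣ ≥ M`. All but `3 * p` of `n` vertices lie in `Γ X ∩ V`; at most `∣ inner ∣`
      -- of these are used, and by tightness at most `2 * p` are free. So `n ≤ 5 * p + ∣ inner ∣`,
      -- which leaves at most `5 * p + 1` leaves, against `13 * p + 1`. Cancelling `p > 0` gives
      -- `13 ≤ 5`.
      tight-small : ∀ (s : Inner.State) → let open Inner.State s in
                    ∀ {X} → SmallTight (col c) bounded w avail X → ∣ X ∣ < M
      tight-small s {X} ((X⊆V , X≤2M) , tight) = ≰⇒> λ M≤X → contradiction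
        (*-cancelʳ-≤ 13 5 p {{>-nonZero 1≤p}} (+-cancelʳ-≤ 1 _ _ (≤-trans many-leaves (+-cancelˡ-≤ n _ _ (begin
          n + ∣ leaf ∣                                    ≤⟨ +-monoˡ-≤ _ (large-expands X X⊆V M≤X X≤2M) ⟩
          ∣ Γ X ∩ V ∣ + 3 * p + ∣ leaf ∣                  ≤⟨ +-monoˡ-≤ _ (+-monoˡ-≤ _ (room (Γ X))) ⟩
          ∣ Γ X ∩ avail ∣ + ∣ dom ∣ + 3 * p + ∣ leaf ∣    ≤⟨ +-monoˡ-≤ _ (+-monoˡ-≤ _
                                                               (+-mono-≤ (≤-trans tight wX≤2p) (card-mono dom⊆))) ⟩
          2 * p + ∣ inner ∣ + 3 * p + ∣ leaf ∣            ≡⟨ solve 3 (λ p i l → con 2 :* p :+ i :+ con 3 :* p :+ l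
                                                               := con 5 :* p :+ (i :+ l)) refl p (∣ inner ∣) (∣ leaf ∣) ⟩
          5 * p + (∣ inner ∣ + ∣ leaf ∣)                  ≤⟨ +-monoʳ-≤ (5 * p) inner+leaves≤ ⟩
          5 * p + (n + 1)                                 ≡⟨ solve 2 (λ p n → con 5 :* p :+ (n :+ con 1)
                                                               := n :+ (con 5 :* p :+ con 1)) refl p n ⟩
          n + (5 * p + 1)                                 ∎)))))
        λ { (s≤s (s≤s (s≤s (s≤s (s≤s ()))))) }
        where
        open ≤-Reasoning
        open Inner.State s
        open +-*-Solver
        wX≤2p : weight w X ≤ 2 * p
        wX≤2p = ≤-trans (weight-mono (λ _ → id) λ i _ → w≤Δ i)
          (≤-trans (≤-reflexive (weight-const Δ X)) (Δ*≤2p X≤2M))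

      Inner-closed : ∀ s → Inner.Closed s
      Inner-closed s = ∪-small , ∪x-small
        where
        open Inner.State s
        ∪-small : ∀ {X Y} → SmallTight (col c) bounded w avail X → SmallTight (col c) bounded w avail Y →
                  SmallSets.Small bounded (X ∪ Y)
        ∪-small {X} {Y} tX tY = (λ i q → [ proj₁ (proj₁ tX) i , proj₁ (proj₁ tY) i ]′ (∪⁻ X Y q)) ,
          ≤-trans (card-cover {A = X ∪ Y} λ _ → id) (≤-trans
            (+-mono-≤ (<⇒≤ (tight-small s tX)) (<⇒≤ (tight-small s tY)))
            (≤-reflexive (cong (M +_) (sym (+-identityʳ M)))))
        ∪x-small : ∀ {X t} → SmallTight (col c) bounded w avail X → t ∈ dom →
                   SmallSets.Small bounded (X ∪ ⁅ img t ⁆)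
        ∪x-small {X} {t} tX t∈ =
          (λ i q → [ proj₁ (proj₁ tX) i , (λ i≡ → subst (_∈ V) (sym (⁅⁆⁻ (img t) i i≡)) (img-host t t∈)) ]′
            (∪⁻ X ⁅ img t ⁆ q)) ,
          (begin
            ∣ X ∪ ⁅ img t ⁆ ∣      ≤⟨ card-cover {A = X ∪ ⁅ img t ⁆} (λ _ → id) ⟩
            ∣ X ∣ + ∣ ⁅ img t ⁆ ∣  ≡⟨ cong (∣ X ∣ +_) (weight-⁅⁆ _ (img t)) ⟩
            ∣ X ∣ + 1              ≡⟨ +-comm ∣ X ∣ 1 ⟩
            suc ∣ X ∣              ≤⟨ tight-small s tX ⟩
            M                      ≤⟨ m≤m+n M _ ⟩
            2 * M                  ∎)
          where open ≤-Reasoning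

      ∉inner-unique : ∀ v → v ∉ inner → ∀ a b → a ∈ adj T v → b ∈ adj T v → a ≡ b
      ∉inner-unique v v∉ = two-elements (≤-reflexive (∉inner⇒leaf v v∉))

      inner-stage : Σ Inner.State λ s → inner ⊆ Inner.State.dom s
      inner-stage = Inner.complete Inner-closed reach ∉inner-unique initial

      module Switch (s : Inner.State) (inner⊆ : inner ⊆ Inner.State.dom s) where
        open Inner.State s

        out : Fin n → ℕ
        out t = ∣ adj T t ∖ dom ∣

        preimage : Fin N → Sub n
        preimage y = dom ∩ λ t → ⁅ img t ⁆ y

        -- By injectivity of `img` the sum has at most one term: the exact number of missing
        -- neighbours at a used vertex, and zero at all others.
        w₂ : Fin N → ℕ
        w₂ y = weight out (preimage y)

        avail₂ : Sub N
        avail₂ = avail ∪ B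

        preimage⁻ : ∀ y {t} → t ∈ preimage y → t ∈ dom × y ≡ img t
        preimage⁻ y {t} q with t∈ , y≡ ← ∩⁻ dom (λ t → ⁅ img t ⁆ y) {t} q = t∈ , ⁅⁆⁻ (img t) y y≡

        w₂≤w : ∀ y → w₂ y ≤ w y
        w₂≤w y = weight-subsingleton out
          (λ t t′ q q′ → img-inj t t′ (proj₁ (preimage⁻ y q)) (proj₁ (preimage⁻ y q′))
            (trans (sym (proj₂ (preimage⁻ y q))) (proj₂ (preimage⁻ y q′))))
          λ t q → subst (λ z → out t ≤ w z) (sym (proj₂ (preimage⁻ y q))) (need t (proj₁ (preimage⁻ y q)))

        -- Every vertex outside dom has at most one neighbour in dom.
        w₂-total : ∀ X → weight w₂ X + ∣ dom ∣ ≤ n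
        w₂-total X = begin
          weight w₂ X + ∣ dom ∣
            ≤⟨ +-monoˡ-≤ _ (weight-fibres img out dom X) ⟩
          weight out dom + ∣ dom ∣
            ≡⟨ cong (_+ ∣ dom ∣) (weight-comm _ dom (λ t → adj T t ∖ dom)) ⟩
          weight into (λ _ → true) + ∣ dom ∣
            ≤⟨ +-monoˡ-≤ _ (weight-support into {Y = ∁ dom} λ u _ u∈ → weight-∅ _ λ t → ¬-not λ q →
                 ∈∉ {X = dom} (trans (sym (Bool.not-involutive (dom u))) (cong not u∈)) (proj₂ (into⁻ u q))) ⟩
          weight into (∁ dom) + ∣ dom ∣
            ≤⟨ +-monoˡ-≤ _ (weight-mono (λ _ → id) λ u u∉ → weight-subsingleton _ (one u) λ _ _ → ≤-refl) ⟩
          ∣ ∁ dom ∣ + ∣ dom ∣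
            ≤⟨ card-∁ dom ⟩
          n ∎
          where
          open ≤-Reasoning
          into : Fin n → ℕ
          into u = ∣ dom ∩ (λ t → (adj T t ∖ dom) u) ∣
          into⁻ : ∀ u {t} → t ∈ dom ∩ (λ t → (adj T t ∖ dom) u) → (t ∈ dom × u ∈ adj T t) × u ∉ dom
          into⁻ u {t} q with t∈ , r ← ∩⁻ dom (λ t → (adj T t ∖ dom) u) {t} q
            with e , u∉ ← ∖⁻ (adj T t) dom {u} r = (t∈ , e) , u∉
          one : ∀ u a b → a ∈ dom ∩ (λ t → (adj T t ∖ dom) u) → b ∈ dom ∩ (λ t → (adj T t ∖ dom) u) → a ≡ b
          one u a b q q′ with (a∈ , au) , u∉ ← into⁻ u {a} q | (b∈ , bu) , _ ← into⁻ u {b} q′ =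
            unique-neighbour T acyclic connected u∉ a b a∈ b∈ au bu

        avail₂∌ : ∀ {z} → z ∈ V → z ∉ avail → z ∉ avail₂
        avail₂∌ {z} z∈V z∉ = cong₂ _∨_ z∉ (proj₂ (∖⁻ S B z∈V))

        room₂ : ∀ Z → ∣ Z ∩ S ∣ ≤ ∣ Z ∩ avail₂ ∣ + ∣ dom ∣
        room₂ Z = begin
          ∣ Z ∩ S ∣                                ≤⟨ card-cover cover ⟩
          ∣ Z ∩ B ∣ + ∣ Z ∩ V ∣                    ≤⟨ +-monoʳ-≤ _ (room Z) ⟩
          ∣ Z ∩ B ∣ + (∣ Z ∩ avail ∣ + ∣ dom ∣)    ≡⟨ sym (+-assoc ∣ Z ∩ B ∣ _ _) ⟩
          ∣ Z ∩ B ∣ + ∣ Z ∩ avail ∣ + ∣ dom ∣      ≤⟨ +-monoˡ-≤ _ (card-disjoint dis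
            (λ z q → ∩⁺ Z avail₂ (proj₁ (∩⁻ Z B q)) (∪⁺ʳ avail B (proj₂ (∩⁻ Z B q))))
            (λ z q → ∩⁺ Z avail₂ (proj₁ (∩⁻ Z avail q)) (∪⁺ˡ avail B (proj₂ (∩⁻ Z avail q))))) ⟩
          ∣ Z ∩ avail₂ ∣ + ∣ dom ∣                 ∎
          where
          open ≤-Reasoning
          cover : Z ∩ S ⊆ (Z ∩ B) ∪ (Z ∩ V)
          cover z q with z∈Z , z∈S ← ∩⁻ Z S q with S-split z∈S
          ... | inj₁ z∈V = ∪⁺ʳ (Z ∩ B) (Z ∩ V) (∩⁺ Z V z∈Z z∈V)
          ... | inj₂ z∈B = ∪⁺ˡ (Z ∩ B) (Z ∩ V) (∩⁺ Z B z∈Z z∈B)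
          dis : ∀ z → z ∈ Z ∩ B → z ∉ Z ∩ avail
          dis z q = ¬-not λ q′ → ∈∉ {X = B} (proj₂ (∩⁻ Z B q))
            (proj₂ (∖⁻ S B (avail⊆ z (proj₂ (∩⁻ Z avail q′)))))

        -- w₂ lives on the vertices of V that are in use, and the total w₂-weight is the number
        -- of vertices still to be embedded, so large sets satisfy Hall's condition by room₂.
        expands₂ : ∀ X → weight w₂ X ≤ ∣ Γ X ∩ avail₂ ∣
        expands₂ X = ≤-trans (weight-support w₂ off) (≤-trans core (card-mono up))
          where
          open ≤-Reasoning
          used = V ∖ avail
          Y = X ∩ used
          off : ∀ y → y ∈ X → y ∉ Y → w₂ y ≡ 0
          off y y∈X y∉Y = weight-∅ out λ t → ¬-not λ q → unused t (preimage⁻ y q)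
            where
            unused : ∀ t → ¬ (t ∈ dom × y ≡ img t)
            unused t (t∈ , refl) = ∈∉ {X = Y} (∩⁺ X used y∈X (∖⁺ V avail (img-host t t∈) (img-used t t∈))) y∉Y
          Y⊆V : Y ⊆ V
          Y⊆V y q = proj₁ (∖⁻ V avail (proj₂ (∩⁻ X used q)))
          up : Γ Y ∩ avail₂ ⊆ Γ X ∩ avail₂
          up z q with z∈Γ , z∈ ← ∩⁻ (Γ Y) avail₂ q =
            ∩⁺ (Γ X) avail₂ (nb-mono (col c) (λ y s → proj₁ (∩⁻ X used s)) z z∈Γ) z∈
          core : weight w₂ Y ≤ ∣ Γ Y ∩ avail₂ ∣
          core with M ≤? ∣ Y ∣
          ... | yes M≤Y = +-cancelʳ-≤ ∣ dom ∣ _ _ (begin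
            weight w₂ Y + ∣ dom ∣                ≤⟨ w₂-total Y ⟩
            n                                    ≤⟨ expanding Y (λ y q → V⊆S y (Y⊆V y q)) M≤Y ⟩
            ∣ (Y ∪ Γ Y) ∩ S ∣                    ≤⟨ room₂ (Y ∪ Γ Y) ⟩
            ∣ (Y ∪ Γ Y) ∩ avail₂ ∣ + ∣ dom ∣     ≤⟨ +-monoˡ-≤ _ (card-mono outside) ⟩
            ∣ Γ Y ∩ avail₂ ∣ + ∣ dom ∣           ∎)
            where
            -- The vertices of `Y` are in use, so they contribute nothing to `avail₂`.
            outside : (Y ∪ Γ Y) ∩ avail₂ ⊆ Γ Y ∩ avail₂
            outside z q with z∈ , z∈₂ ← ∩⁻ (Y ∪ Γ Y) avail₂ q with ∪⁻ Y (Γ Y) z∈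
            ... | inj₂ z∈Γ = ∩⁺ (Γ Y) avail₂ z∈Γ z∈₂
            ... | inj₁ z∈Y = ∈∉ {X = avail₂} z∈₂
              (avail₂∌ (Y⊆V z z∈Y) (proj₂ (∖⁻ V avail (proj₂ (∩⁻ X used z∈Y)))))
          -- Below `M` the expansion of the first stage is inherited: demands have only dropped and
          -- free vertices have only been added.
          ... | no Y<M = begin
            weight w₂ Y           ≤⟨ weight-mono (λ _ → id) (λ y _ → w₂≤w y) ⟩
            weight w Y            ≤⟨ expands Y (Y⊆V , ≤-trans (<⇒≤ (≰⇒> Y<M)) (m≤m+n M _)) ⟩
            ∣ Γ Y ∩ avail ∣       ≤⟨ card-mono (λ z q → ∩⁺ (Γ Y) avail₂ (proj₁ (∩⁻ (Γ Y) avail q))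
                                         (∪⁺ˡ avail B (proj₂ (∩⁻ (Γ Y) avail q)))) ⟩
            ∣ Γ Y ∩ avail₂ ∣      ∎

        switched : Whole.State
        switched = record
          { dom = dom ; img = img ; avail = avail₂ ; w = w₂
          ; inhabited = inhabited
          ; dom⊆ = λ _ _ → refl
          ; connected = connected
          ; img-inj = img-inj
          ; img-edge = img-edge
          ; img-host = λ t t∈ → V⊆S _ (img-host t t∈)
          ; img-used = λ t t∈ → avail₂∌ (img-host t t∈) (img-used t t∈)
          ; avail⊆ = λ z q → [ V⊆S z ∘ avail⊆ z , B⊆S z ]′ (∪⁻ avail B q)
          ; room = room₂
          ; need = λ t t∈ → ∈⇒≤weight out (preimage (img t))
              (∩⁺ dom (λ t′ → ⁅ img t′ ⁆ (img t)) {t} t∈ (⁅⁆⁺ (img t)))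
          -- What is still missing is a leaf, and its degree one is covered by demand zero.
          ; capacity = λ t y _ t∉ _ → ≤-trans (≤-reflexive
              (∉inner⇒leaf t (¬-not λ t∈ → ∈∉ {X = dom} (inner⊆ t t∈) t∉))) (s≤s z≤n)
          ; w≤Δ = λ y → ≤-trans (w₂≤w y) (w≤Δ y)
          ; expands = λ X _ → expands₂ X
          }

    embed : MonoCopy T c true
    embed with s , inner⊆ ← inner-stage
      -- Every set is small in this stage, so `Closed` is trivial.
      with s′ , all ← Whole.complete (λ _ → (λ _ _ → tt) , λ _ _ → tt) reach (λ _ ())
        (Switch.switched s inner⊆) =
      img , (λ {a} {b} → img-inj a b (all a refl) (all b refl)) ,
      λ a b → img-edge a b (all a refl) (all b refl)
      where open Whole.State s′

-- Colour classes and Ramsey numbers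

-- `d` is the default value off `X`, where nothing is claimed.
card-≤⇒injection : ∀ {m N} (X : Sub m) (Y : Sub N) → Fin N → ∣ X ∣ ≤ ∣ Y ∣ →
  Σ (Fin m → Fin N) λ e → (∀ v → v ∈ X → e v ∈ Y) × (∀ v w → v ∈ X → w ∈ X → e v ≡ e w → v ≡ w)
card-≤⇒injection {zero}  X Y d X≤Y = (λ ()) , (λ ()) , λ ()
card-≤⇒injection {suc m} X Y d X≤Y with X zero in X0 | card-suc X
... | false | ∣X∣ with e , into , inj ← card-≤⇒injection (X ∘ suc) Y d (subst (_≤ ∣ Y ∣) ∣X∣ X≤Y) =
  (λ { zero → d ; (suc v) → e v }) ,
  (λ { zero p → ∈∉ {X = X} {zero} p X0 ; (suc v) p → into v p }) ,
  λ { zero _ p _ _ → ∈∉ {X = X} {zero} p X0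
    ; (suc _) zero _ q _ → ∈∉ {X = X} {zero} q X0
    ; (suc v) (suc w) p q eq → cong suc (inj v w p q eq) }
... | true | ∣X∣ with y , y∈Y ← nonempty Y (≤-trans (s≤s z≤n) (subst (_≤ ∣ Y ∣) ∣X∣ X≤Y))
  with e , into , inj ← card-≤⇒injection (X ∘ suc) (Y ∖ ⁅ y ⁆) d (≤-pred (≤-trans
    (subst (_≤ ∣ Y ∣) ∣X∣ X≤Y) (≤-trans (card-remove (λ _ → true) Y y) (≤-reflexive (+-comm _ 1))))) =
  (λ { zero → y ; (suc v) → e v }) ,
  (λ { zero _ → y∈Y ; (suc v) p → proj₁ (∖⁻ Y ⁅ y ⁆ (into v p)) }) ,
  λ { zero zero _ _ _ → refl
    ; zero (suc w) _ q eq → contradiction (sym eq) (≢y w q)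
    ; (suc v) zero p _ eq → contradiction eq (≢y v p)
    ; (suc v) (suc w) p q eq → cong suc (inj v w p q eq) }
  where
  ≢y : ∀ v → suc v ∈ X → e v ≢ y
  ≢y v p eq = ∈∉ {X = ⁅ y ⁆} {e v} (subst (λ z → z ∈ ⁅ y ⁆) (sym eq) (⁅⁆⁺ y)) (proj₂ (∖⁻ Y ⁅ y ⁆ (into v p)))

-- `Red` abstracts the red copy of the tree. The class of `a`, later one of size `σ(H)`, is placed
-- last, when only that many vertices are sure to remain.
module BlueEmbedding {N n m k : ℕ} (c : EdgeColouring N) (φ : Fin m → Fin k) (d : Fin N) {Red : Set}
  (red : ∀ S → n ≤ ∣ S ∣ → (∀ X → X ⊆ S → m ≤ ∣ X ∣ → n ≤ ∣ (X ∪ nb (col c) X) ∩ S ∣) → Red)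
  (a : Fin k) where

  class : Fin k → Sub m
  class b v = ⁅ b ⁆ (φ v)

  Covered : List (Fin k) → Fin m → Set
  Covered bs v = φ v ≡ a ⊎ Any (φ v ≡_) bs

  -- A blue copy inside S of the complete multipartite graph on the colour classes of a and bs.
  record Blue (bs : List (Fin k)) (S : Sub N) : Set where
    field
      at   : Fin m → Fin N
      into : ∀ v → Covered bs v → at v ∈ S
      inj  : ∀ v w → Covered bs v → Covered bs w → at v ≡ at w → v ≡ w
      blue : ∀ v w → Covered bs v → Covered bs w → φ v ≢ φ w → col c (at v) (at w) ≡ false
  open Blue

  -- If some `X` splits `S`, the class of `b` goes into `X` and the rest into `far X`, to which `X`
  -- has only blue edges. If none does, `red` applies to `S`.
  colour-classes : 0 < ∣ class a ∣ → ∀ bs S → (n ∸ 1) * length bs + ∣ class a ∣ ≤ ∣ S ∣ → Red ⊎ Blue bs S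
  colour-classes _ [] S ≤S
    with e , into , inj ← card-≤⇒injection (class a) S d (≤-trans (m≤n+m _ ((n ∸ 1) * 0)) ≤S) = inj₂ record
    { at   = e
    ; into = λ v p → into v (in-class v p)
    ; inj  = λ v w p q → inj v w (in-class v p) (in-class w q)
    ; blue = λ v w p q φ≢ → contradiction (trans (only v p) (sym (only w q))) φ≢
    }
    where
    only : ∀ v → Covered [] v → φ v ≡ a
    only v (inj₁ p) = p
    in-class : ∀ v → Covered [] v → v ∈ class a
    in-class v p = subst (λ b → b ∈ ⁅ a ⁆) (sym (only v p)) (⁅⁆⁺ a)
  colour-classes 0<a (b ∷ bs) S ≤S = decide (anySub? Splits? Splits-resp)
    where
    Γ : Sub N → Sub N
    Γ = nb (col c)

    rest : ℕ
    rest = (n ∸ 1) * length bs + ∣ class a ∣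

    far : Sub N → Sub N
    far X = S ∖ (X ∪ Γ X)

    Splits : Sub N → Set
    Splits X = X ⊆ S × ∣ class b ∣ ≤ ∣ X ∣ × rest ≤ ∣ far X ∣

    Splits? : ∀ X → Dec (Splits X)
    Splits? X = all? (λ i → ∈? X i →-dec ∈? S i) ×-dec (∣ class b ∣ ≤? ∣ X ∣) ×-dec (rest ≤? ∣ far X ∣)

    Splits-resp : ∀ {X Y} → X ≗ Y → Splits X → Splits Y
    Splits-resp eq (X⊆S , b≤X , rest≤) = (λ i q → X⊆S i (trans (eq i) q)) ,
      subst (∣ class b ∣ ≤_) (weight-cong _ eq) b≤X ,
      subst (rest ≤_) (weight-cong _ λ z →
        cong (λ t → S z ∧ not t) (cong₂ _∨_ (eq z) (nb-cong (col c) eq z))) rest≤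

    combined : ∀ X → Splits X → Blue bs (far X) → Blue (b ∷ bs) S
    combined X (X⊆S , b≤X , _) β with e , e∈X , e-inj ← card-≤⇒injection (class b) X d b≤X = record
      { at   = at′
      ; into = λ v p → [ (λ v∈b → subst (_∈ S) (sym (at-new v v∈b)) (X⊆S _ (e∈X v v∈b)))
                       , (λ (v∉b , q) → subst (_∈ S) (sym (at-old v v∉b))
                           (proj₁ (∖⁻ S (X ∪ Γ X) (into β v q)))) ]′ (split v p)
      ; inj  = inj′
      ; blue = blue′
      }
      where
      at′ : Fin m → Fin N
      at′ v = if class b v then e v else at β v
      at-new : ∀ v → v ∈ class b → at′ v ≡ e v
      at-new v v∈b rewrite v∈b = refl
      at-old : ∀ v → v ∉ class b → at′ v ≡ at β v
      at-old v v∉b rewrite v∉b = refl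
      split : ∀ v → Covered (b ∷ bs) v → v ∈ class b ⊎ (v ∉ class b × Covered bs v)
      split v p with mem? (class b) v
      ... | inj₁ v∈b = inj₁ v∈b
      ... | inj₂ v∉b = inj₂ (v∉b , uncovered p)
        where
        uncovered : Covered (b ∷ bs) v → Covered bs v
        uncovered (inj₁ q)         = inj₁ q
        uncovered (inj₂ (here q))  = ∈∉ {X = class b} {v} (subst (λ i → i ∈ ⁅ b ⁆) (sym q) (⁅⁆⁺ b)) v∉b
        uncovered (inj₂ (there q)) = inj₂ q
      avoids : ∀ v → Covered bs v → at β v ∉ X ∪ Γ X
      avoids v q = proj₂ (∖⁻ S (X ∪ Γ X) (into β v q))
      e≢at : ∀ v w → v ∈ class b → Covered bs w → e v ≢ at β w
      e≢at v w v∈b q eq = ∈∉ {X = X ∪ Γ X} {at β w} (∪⁺ˡ X (Γ X) (subst (_∈ X) eq (e∈X v v∈b))) (avoids w q)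
      e-at-blue : ∀ v w → v ∈ class b → Covered bs w → col c (e v) (at β w) ≡ false
      e-at-blue v w v∈b q = ¬-not λ r →
        ∈∉ {X = X ∪ Γ X} {at β w} (∪⁺ʳ X (Γ X) (nb⁺ (col c) X (e∈X v v∈b) r)) (avoids w q)
      inj′ : ∀ v w → Covered (b ∷ bs) v → Covered (b ∷ bs) w → at′ v ≡ at′ w → v ≡ w
      inj′ v w p q eq with split v p | split w q
      ... | inj₁ v∈b | inj₁ w∈b =
        e-inj v w v∈b w∈b (trans (sym (at-new v v∈b)) (trans eq (at-new w w∈b)))
      ... | inj₁ v∈b | inj₂ (w∉b , w∈bs) = contradiction
        (trans (sym (at-new v v∈b)) (trans eq (at-old w w∉b))) (e≢at v w v∈b w∈bs)
      ... | inj₂ (v∉b , v∈bs) | inj₁ w∈b = contradiction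
        (trans (sym (at-new w w∈b)) (trans (sym eq) (at-old v v∉b))) (e≢at w v w∈b v∈bs)
      ... | inj₂ (v∉b , v∈bs) | inj₂ (w∉b , w∈bs) =
        inj β v w v∈bs w∈bs (trans (sym (at-old v v∉b)) (trans eq (at-old w w∉b)))
      blue′ : ∀ v w → Covered (b ∷ bs) v → Covered (b ∷ bs) w → φ v ≢ φ w → col c (at′ v) (at′ w) ≡ false
      blue′ v w p q φ≢ with split v p | split w q
      ... | inj₁ v∈b | inj₁ w∈b = contradiction (trans (⁅⁆⁻ b (φ v) v∈b) (sym (⁅⁆⁻ b (φ w) w∈b))) φ≢
      ... | inj₁ v∈b | inj₂ (w∉b , w∈bs) =
        trans (cong₂ (col c) (at-new v v∈b) (at-old w w∉b)) (e-at-blue v w v∈b w∈bs)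
      ... | inj₂ (v∉b , v∈bs) | inj₁ w∈b =
        trans (cong₂ (col c) (at-old v v∉b) (at-new w w∈b)) (trans (colSym c _ _) (e-at-blue w v w∈b v∈bs))
      ... | inj₂ (v∉b , v∈bs) | inj₂ (w∉b , w∈bs) =
        trans (cong₂ (col c) (at-old v v∉b) (at-old w w∉b)) (blue β v w v∈bs w∈bs φ≢)

    n≤1+[n∸1] : ∀ n → n ≤ suc (n ∸ 1)
    n≤1+[n∸1] zero    = z≤n
    n≤1+[n∸1] (suc n) = ≤-refl

    n+rest≤S : (n ∸ 1) + rest ≤ ∣ S ∣
    n+rest≤S = ≤-trans (≤-reflexive (trans (sym (+-assoc (n ∸ 1) ((n ∸ 1) * length bs) ∣ class a ∣))
      (cong (_+ ∣ class a ∣) (sym (*-suc (n ∸ 1) (length bs)))))) ≤S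

    -- As `far X` has fewer than `rest` elements and `S` at least `(n ∸ 1) + rest`, more than
    -- `n ∸ 1` vertices lie in `X ∪ Γ X`.
    near-large : ¬ ∃ Splits → ∀ X → X ⊆ S → ∣ class b ∣ ≤ ∣ X ∣ → n ≤ ∣ (X ∪ Γ X) ∩ S ∣
    near-large none X X⊆S b≤X = ≤-trans (n≤1+[n∸1] n) (+-cancelʳ-< rest _ _ (begin-strict
      (n ∸ 1) + rest                               ≤⟨ n+rest≤S ⟩
      ∣ S ∣                                        ≤⟨ card-cover cover ⟩
      ∣ (X ∪ Γ X) ∩ S ∣ + ∣ far X ∣                <⟨ +-monoʳ-< _ (≰⇒> λ rest≤ →
                                                        none (X , X⊆S , b≤X , rest≤)) ⟩
      ∣ (X ∪ Γ X) ∩ S ∣ + rest                     ∎))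
      where
      open ≤-Reasoning
      cover : S ⊆ ((X ∪ Γ X) ∩ S) ∪ far X
      cover z z∈S with mem? (X ∪ Γ X) z
      ... | inj₁ z∈ = ∪⁺ˡ ((X ∪ Γ X) ∩ S) (far X) (∩⁺ (X ∪ Γ X) S z∈ z∈S)
      ... | inj₂ z∉ = ∪⁺ʳ ((X ∪ Γ X) ∩ S) (far X) (∖⁺ S (X ∪ Γ X) z∈S z∉)

    decide : Dec (∃ Splits) → Red ⊎ Blue (b ∷ bs) S
    decide (yes (X , sp)) with colour-classes 0<a bs (far X) (proj₂ (proj₂ sp))
    ... | inj₁ r = inj₁ r
    ... | inj₂ β = inj₂ (combined X sp β)
    -- A class has at most `m` elements, so every `X` with `m ≤ ∣ X ∣` could have held it.
    decide (no none) = inj₁ (red S n≤S λ X X⊆S m≤X →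
      near-large none X X⊆S (≤-trans (card≤n (class b)) m≤X))
      where
      open ≤-Reasoning
      n≤S : n ≤ ∣ S ∣
      n≤S = begin
        n               ≤⟨ n≤1+[n∸1] n ⟩
        suc (n ∸ 1)     ≡⟨ +-comm 1 (n ∸ 1) ⟩
        (n ∸ 1) + 1     ≤⟨ +-monoʳ-≤ (n ∸ 1) (≤-trans 0<a (m≤n+m _ ((n ∸ 1) * length bs))) ⟩
        (n ∸ 1) + rest  ≤⟨ n+rest≤S ⟩
        ∣ S ∣           ∎

-- The colouring for the lower bound

module BlockColouring (s k n : ℕ) where

  -- The parameters will be `s = σ(H) - 1`, `k = χ(H) - 1` and `n = ∣ T ∣ - 1`; block `zero` is the
  -- short one.
  block : Fin (s + k * n) → Fin (suc k)
  block i = [ (λ _ → zero) , (λ x → suc (proj₁ (remQuot {k} n x))) ]′ (splitAt s i)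

  block-zero : ∀ i → block i ≡ zero → ∃[ j ] j ↑ˡ (k * n) ≡ i
  block-zero i p with splitAt s i in eq
  ... | inj₁ j = j , splitAt⁻¹-↑ˡ eq

  block-suc : ∀ i {q} → block i ≡ suc q → ∃[ r ] s ↑ʳ combine q r ≡ i
  block-suc i {q} p with splitAt s i in eq
  ... | inj₂ x = proj₂ (remQuot {k} n x) ,
    trans (cong (λ q → s ↑ʳ combine q _) (sym (suc-injective p)))
      (trans (cong (s ↑ʳ_) (combine-remQuot {k} n x)) (splitAt⁻¹-↑ʳ eq))

  -- Restricting to the first `M` vertices treats every number of vertices below the claimed Ramsey
  -- number at once.
  blocks : ∀ {M} → M ≤ s + k * n → EdgeColouring M
  blocks M≤ = record
    { col    = λ i j → ⁅ block (inject≤ j M≤) ⁆ (block (inject≤ i M≤))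
    ; colSym = λ i j → symm (block (inject≤ i M≤)) (block (inject≤ j M≤)) }
    where
    symm : ∀ (a b : Fin (suc k)) → does (a ≟ b) ≡ does (b ≟ a)
    symm a b with a ≟ b
    ... | yes refl = sym (⁅⁆⁺ a)
    ... | no a≢b   = sym (≢⇒∉⁅⁆ a b (a≢b ∘ sym))

  module _ {M m : ℕ} (M≤ : M ≤ s + k * n) where

    -- Red edges stay inside a block, so a connected red graph fits into a single one.
    red-copy-small : ∀ {t} {T : Graph t} → Connected T → MonoCopy T (blocks M≤) true → t ≤ s ⊎ t ≤ n
    red-copy-small {t} {T} (1≤t , reach) (f , f-inj , red) = by-block (block (g root)) refl
      where
      root = fromℕ< 1≤t
      g : Fin t → Fin (s + k * n)
      g v = inject≤ (f v) M≤
      g-inj : ∀ v w → g v ≡ g w → v ≡ w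
      g-inj v w eq = f-inj (inject≤-injective M≤ M≤ _ _ eq)
      same : ∀ {u v} → Reach T u v → block (g u) ≡ block (g v)
      same here = refl
      same (step {u} {w} e r) = trans (⁅⁆⁻ (block (g w)) (block (g u)) (red u w e)) (same r)
      by-block : ∀ b → block (g root) ≡ b → t ≤ s ⊎ t ≤ n
      by-block zero p = inj₁ (injective⇒≤ {f = λ v → proj₁ (loc v)} λ {v} {w} eq → g-inj v w
        (trans (sym (proj₂ (loc v))) (trans (cong (_↑ˡ (k * n)) eq) (proj₂ (loc w)))))
        where
        loc : ∀ v → ∃[ j ] j ↑ˡ (k * n) ≡ g v
        loc v = block-zero (g v) (trans (sym (same (reach root v))) p)
      by-block (suc q) p = inj₂ (injective⇒≤ {f = λ v → proj₁ (loc v)} λ {v} {w} eq → g-inj v w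
        (trans (sym (proj₂ (loc v))) (trans (cong (λ r → s ↑ʳ combine q r) eq) (proj₂ (loc w)))))
        where
        loc : ∀ v → ∃[ r ] s ↑ʳ combine q r ≡ g v
        loc v = block-suc (g v) (trans (sym (same (reach root v))) p)

    -- Blue edges join different blocks, so the blocks colour `H` properly, and one class lies in
    -- the short block.
    blue-copy-colours : (H : Graph m) → MonoCopy H (blocks M≤) false →
                        Σ (ProperColouring H (suc k)) λ P → classSize (proj₁ P) zero ≤ s
    blue-copy-colours H (f , f-inj , blue) = (block ∘ g , proper) ,
      ≤-trans (≤-reflexive (count≡∣∣ _)) (card-matching (λ v j → ⁅ g v ⁆ (j ↑ˡ (k * n))) matched unmatched)
      where
      g : Fin m → Fin (s + k * n)
      g v = inject≤ (f v) M≤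
      proper : ∀ v w → adj H v w ≡ true → block (g v) ≢ block (g w)
      proper v w e eq = ∈∉ {X = ⁅ block (g w) ⁆} {block (g v)}
        (subst (λ b → b ∈ ⁅ block (g w) ⁆) (sym eq) (⁅⁆⁺ (block (g w)))) (blue v w e)
      matched : ∀ v → ⁅ zero ⁆ (block (g v)) ≡ true → ∃[ j ] ⁅ g v ⁆ (j ↑ˡ (k * n)) ≡ true
      matched v p with j , eq ← block-zero (g v) (⁅⁆⁻ zero (block (g v)) p) =
        j , subst (λ z → z ∈ ⁅ g v ⁆) (sym eq) (⁅⁆⁺ (g v))
      unmatched : ∀ v w j → ⁅ zero ⁆ (block (g v)) ≡ true → ⁅ zero ⁆ (block (g w)) ≡ true →
                  ⁅ g v ⁆ (j ↑ˡ (k * n)) ≡ true → ⁅ g w ⁆ (j ↑ˡ (k * n)) ≡ true → v ≡ w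
      unmatched v w j _ _ p q = f-inj (inject≤-injective M≤ M≤ _ _
        (trans (sym (⁅⁆⁻ (g v) (j ↑ˡ (k * n)) p)) (⁅⁆⁻ (g w) (j ↑ˡ (k * n)) q)))

-- An empty class would allow a colouring with one colour less.
class-inhabited : ∀ {m k} (H : Graph m) → IsChromaticNumber H k → (P : ProperColouring H k) →
                  ∀ a → 0 < classSize (proj₁ P) a
class-inhabited {k = suc k} H (_ , minimal) (φ , proper) a = ≰⇒> λ size≤0 →
  let misses : ∀ v → a ≢ φ v
      misses v a≡ = contradiction (≤-trans (≤-trans
        (∈⇒≤weight (λ _ → 1) (λ v → ⁅ a ⁆ (φ v)) (trans (cong ⁅ a ⁆ (sym a≡)) (⁅⁆⁺ a)))
        (≤-reflexive (sym (count≡∣∣ _)))) size≤0) λ ()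
  in <-irrefl refl (minimal k ((λ v → punchOut (misses v)) ,
       λ v w e eq → proper v w e (punchOut-injective (misses v) (misses w) eq)))

ramsey-lower : ∀ {n m k s} (T : Graph n) (H : Graph m) → Connected T → m < n →
               IsChromaticNumber H k → IsSigma H k s →
               ∀ M → Arrows M T H → (n ∸ 1) * (k ∸ 1) + s ≤ M
ramsey-lower {suc n} {m} {k} {s} T H conn m<n χ (((φ , proper) , a , size≡) , minimal) M arrows =
  ≮⇒≥ (go k s χ φ proper a size≡ minimal)
  where
  go : ∀ k s → IsChromaticNumber H k →
       (φ : Fin m → Fin k) → (∀ i j → adj H i j ≡ true → φ i ≢ φ j) → ∀ a → classSize φ a ≡ s →
       (∀ (P : ProperColouring H k) b → s ≤ classSize (proj₁ P) b) → ¬ (M < n * (k ∸ 1) + s)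
  -- `σ(H)` is positive because no class of an optimal colouring is empty; so its predecessor is a
  -- genuine block size.
  go (suc k) zero χ φ proper a size≡ _ _ =
    contradiction (subst (0 <_) size≡ (class-inhabited H χ (φ , proper) a)) λ ()
  go (suc k) (suc s) χ φ proper a size≡ minimal M< = [ no-red , no-blue ]′ (arrows (blocks M≤))
    where
    open BlockColouring s k n
    M≤ : M ≤ s + k * n
    M≤ = ≤-pred (≤-trans M< (≤-reflexive (trans (+-comm (n * k) (suc s)) (cong (suc s +_) (*-comm n k)))))
    s<m : s < m
    s<m = ≤-trans (≤-reflexive (trans (sym size≡) (count≡∣∣ _))) (card≤n _)
    no-red : ¬ MonoCopy T (blocks M≤) true
    no-red copy with red-copy-small {m = m} M≤ conn copy
    -- The short block has fewer vertices than `H`, and `H` has fewer than `T`.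
    ... | inj₁ n≤s = <-irrefl refl (≤-<-trans n≤s (<-trans s<m m<n))
    ... | inj₂ n≤n = <-irrefl refl n≤n
    no-blue : ¬ MonoCopy H (blocks M≤) false
    -- This would be a colouring of `H` with `χ(H)` colours and a class smaller than `σ(H)`.
    no-blue copy with P , size≤s ← blue-copy-colours M≤ H copy =
      <-irrefl refl (≤-trans (minimal P zero) size≤s)

ramsey-upper : ∀ {n m k s} (T : Graph n) (H : Graph m) →
  (∀ {N} (c : EdgeColouring N) S → n ≤ ∣ S ∣ →
     (∀ X → X ⊆ S → m ≤ ∣ X ∣ → n ≤ ∣ (X ∪ nb (col c) X) ∩ S ∣) → MonoCopy T c true) →
  IsChromaticNumber H k → IsSigma H k s → Arrows ((n ∸ 1) * (k ∸ 1) + s) T H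
ramsey-upper {n} {m} {suc k} {s} T H embeds χ (((φ , proper) , a , size≡) , _) c =
  copy (colour-classes 0<class others (λ _ → true) enough)
  where
  0<s : 0 < s
  0<s = subst (0 <_) size≡ (class-inhabited H χ (φ , proper) a)
  -- The default vertex exists because the host has at least `s > 0` vertices.
  open BlueEmbedding {n = n} c φ (fromℕ< (≤-trans 0<s (m≤n+m s ((n ∸ 1) * k)))) (embeds c) a
  class≡s : ∣ class a ∣ ≡ s
  class≡s = trans (sym (count≡∣∣ _)) size≡
  0<class : 0 < ∣ class a ∣
  0<class = subst (0 <_) (sym class≡s) 0<s
  others : List (Fin (suc k))
  others = tabulate (punchIn a)
  -- There are `k` colours other than `a`, so the full host has exactly the required size.
  enough : (n ∸ 1) * length others + ∣ class a ∣ ≤ ∣ (λ (_ : Fin ((n ∸ 1) * k + s)) → true) ∣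
  enough = ≤-reflexive (trans (cong₂ (λ l t → (n ∸ 1) * l + t) (length-tabulate (punchIn a)) class≡s)
    (sym (card-all λ _ → refl)))
  covered : ∀ v → Covered others v
  covered v with a ≟ φ v
  ... | yes a≡ = inj₁ (sym a≡)
  ... | no a≢  = inj₂ (tabulate⁺ (punchOut a≢) (sym (punchIn-punchOut a≢)))
  copy : MonoCopy T c true ⊎ Blue others (λ _ → true) → MonoCopy T c true ⊎ MonoCopy H c false
  copy (inj₁ r) = inj₁ r
  copy (inj₂ β) = inj₂ (at , (λ {v} {w} → inj v w (covered v) (covered w)) ,
    λ v w e → blue v w (covered v) (covered w) (proper v w e))
    where open Blue β

theorem1p2 : ∀ {n m} (T : Graph n) (H : Graph m) (l Δ : ℕ) →
    IsTree T → numLeaves T ≡ l → MaxDegreeAtMost T Δ →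
    13 * Δ * m + 1 ≤ l →
    IsGood T H
theorem1p2 {n} {m} T H l Δ (conn@(1≤n , reach) , acyclic) leaves≡ deg≤ many =
  conn , λ _ _ χ σ → ramsey-upper T H embeds χ σ , ramsey-lower T H conn m<n χ σ
  where
  root = fromℕ< 1≤n
  deg≡ : ∀ v → degree T v ≡ ∣ adj T v ∣
  deg≡ v = count≡∣∣ (adj T v)
  deg≤Δ : ∀ v → ∣ adj T v ∣ ≤ Δ
  deg≤Δ v = subst (_≤ Δ) (deg≡ v) (deg≤ v)
  leaves : Sub n
  leaves v = does (∣ adj T v ∣ ℕ.≟ 1)
  ∣leaves∣ : ∣ leaves ∣ ≡ l
  ∣leaves∣ = trans (weight-cong _ λ v → cong (λ d → does (d ℕ.≟ 1)) (sym (deg≡ v)))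
    (trans (sym (count≡∣∣ _)) leaves≡)
  many-leaves : 13 * (Δ * m) + 1 ≤ ∣ leaves ∣
  many-leaves = subst₂ _≤_ (cong (_+ 1) (*-assoc 13 Δ m)) (sym ∣leaves∣) many
  1≤Δ : 1 ≤ Δ
  -- There is at least one leaf, and its degree is one.
  1≤Δ with v , v∈ ← nonempty leaves (≤-trans (m≤n+m 1 (13 * (Δ * m))) many-leaves) =
    subst (_≤ Δ) (≡ᵇ⇒≡ (∣ adj T v ∣) 1 (subst IsTrue (sym v∈) tt)) (deg≤Δ v)
  m<n : m < n
  m<n = begin-strict
    m                 ≡⟨ sym (*-identityˡ m) ⟩
    1 * m             ≤⟨ *-monoˡ-≤ m 1≤Δ ⟩
    Δ * m             ≤⟨ m≤n*m (Δ * m) 13 ⟩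
    13 * (Δ * m)      <⟨ m<m+n _ (s≤s z≤n) ⟩
    13 * (Δ * m) + 1  ≤⟨ many-leaves ⟩
    ∣ leaves ∣        ≤⟨ card≤n leaves ⟩
    n                 ∎
    where open ≤-Reasoning
  embeds : ∀ {N} (c : EdgeColouring N) S → n ≤ ∣ S ∣ →
    (∀ X → X ⊆ S → m ≤ ∣ X ∣ → n ≤ ∣ (X ∪ nb (col c) X) ∩ S ∣) → MonoCopy T c true
  embeds c = embed T c Δ m root acyclic reach deg≤Δ 1≤Δ many-leaves
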